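{- There exists an infinite sequence $(\Gamma_n)_{n=1}^\infty$ of CNF formulas such that $\Gamma_n$ admits $\mathsf{SBC}^-$ proofs of size $n^{O(1)}$ but requires $\mathsf{RAT}^-$ proofs of size $2^{\Omega(n)}$.
   Context: A literal is a propositional variable or its negation; $\overline{p}$ is the complement of $p$, and $\overline{L}=\{\overline{p} : p\in L\}$ for a set $L$ of literals. A set of literals is tautological if it contains some $x$ and $\overline{x}$. A clause is a finite nontautological set of literals (read as a disjunction); $\bot$ is the empty clause. A CNF is a finite set of clauses; $\mathrm{var}(\Gamma)$ is the set of variables occurring in $\Gamma$. "Proof" of $\Gamma$ means refutation. Resolution. If $A\cup\{x\}$ and $B\cup\{\overline{x}\}$ are clauses with $x$ a variable not occurring in $A$ or $B$, and $A\cup B$ is a clause, then $A\cup B$ is their resolvent on $x$. A weakening of a clause $A$ is any clause $A\cup B$. A resolution proof of $\Gamma$ is a sequence $(\Gamma_1,\dots,\Gamma_N)$ of CNFs with $\Gamma_1=\Gamma$, $\bot\in\Gamma_N$, and each $\Gamma_{i+1}=\Gamma_i\cup\{C\}$, where $C$ is a resolvent of two clauses of $\Gamma_i$ or a weakening of a clause of $\Gamma_i$. Its size is $N$. Unit propagation. A unit propagation proof is a resolution proof in which, in each use of the resolution rule, one of the two premises is a clause with a single literal. For a set $L$ of literals, $\Gamma\vdash_1 L$ means that $\Gamma\cup\{\{\overline{p}\} : p\in L\}$ has a unit propagation proof. RAT. A clause $C=\{p\}\cup C'$ (with the variable of $p$ not in $C'$) is a RAT for $p$ with respect to $\Gamma$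 if for every clause $D\in\Gamma$ of the form $\{\overline{p}\}\cup D'$ (with the variable of $p$ not in $D'$) we have $\Gamma\vdash_1 C'\cup D'$. $C$ is a RAT with respect to $\Gamma$ if it is one for some $p\in C$. SBC. A clause $C$ is a set-blocked clause (SBC) for a nonempty $L\subseteq C$ with respect to $\Gamma$ if for every $D\in\Gamma$ with $D\cap\overline{L}\neq\varnothing$ and $D\cap L=\varnothing$ the set $(C\setminus L)\cup(D\setminus\overline{L})$ is tautological. $C$ is an SBC with respect to $\Gamma$ if it is one for some nonempty $L\subseteq C$. A $\mathsf{RAT}$ (respectively $\mathsf{SBC}$) proof of $\Gamma$ is defined like a resolution proof, except that each added clause $C$ may also be any RAT (respectively SBC) with respect to the current CNF $\Gamma_i$; its size is $N$. The superscript "$-$" means that only variables of $\mathrm{var}(\Gamma)$ may occur in the proof. -}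

module Defs where

open import Data.List.Base using (List; []; _∷_; _++_; [_]; map; concatMap; filter)
open import Data.List.Membership.Propositional using (_∈_; _∉_)
import Data.List.Membership.DecPropositional as DecMembership
import Data.List.Membership.Setoid as SetoidMembership
open import Data.List.Relation.Binary.BagAndSetEquality using (_∼[_]_; set; [_]-Equality)
open import Data.List.Relation.Binary.Disjoint.Propositional using (Disjoint)
open import Data.List.Relation.Binary.Subset.Propositional using (_⊆_)
open import Data.List.Relation.Unary.Any using (here)
open import Data.Nat.Base using (ℕ; suc; _≤_; _^_)
import Data.Nat.Properties as ℕ
open import Data.Product.Base using (∃; ∃-syntax; _×_; _,_)
open import Data.Sum.Base using (_⊎_)
open import Level using (0ℓ)
open import Relation.Binary.Bundles using (Setoid)
import Relation.Binary.Construct.On as On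
open import Relation.Binary.Definitions using (DecidableEquality)
open import Relation.Binary.PropositionalEquality using (_≡_; _≢_; refl; cong)
open import Relation.Nullary using (¬_; yes; no; ¬?)
open import Relation.Nullary.Decidable using (map′)

Var : Set
Var = ℕ

data Literal : Set where
  pos neg : Var → Literal

var : Literal → Var
var (pos x) = x
var (neg x) = x

compl : Literal → Literal
compl (pos x) = neg x
compl (neg x) = pos x

infix 4 _≟_
_≟_ : DecidableEquality Literal
pos x ≟ pos y = map′ (cong pos) (λ { refl → refl }) (x ℕ.≟ y)
pos x ≟ neg y = no λ ()
neg x ≟ pos y = no λ ()
neg x ≟ neg y = map′ (cong neg) (λ { refl → refl }) (x ℕ.≟ y)

open DecMembership _≟_ using (_∈?_)

-- Finite sets of literals are lists, always compared by set equality
-- (_∼[ set ]_: having the same members); union is _++_.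
Literals : Set
Literals = List Literal

complAll : Literals → Literals
complAll = map compl

infixl 6 _∖_
_∖_ : Literals → Literals → Literals
K ∖ L = filter (λ p → ¬? (p ∈? L)) K

vars : Literals → List Var
vars = map var

Tautological : Literals → Set
Tautological L = ∃[ x ] (pos x ∈ L × neg x ∈ L)

record Clause : Set where
  constructor clause
  field
    literals        : Literals
    nontautological : ¬ Tautological literals

open Clause public

-- The setoid equality ignores order, repetitions and the nontautology proof.
Clauses : Setoid 0ℓ 0ℓ
Clauses = On.setoid ([ set ]-Equality Literal) literals

-- A finite set of clauses is a list, with membership up to equality of
-- clauses as sets.
CNF : Set
CNF = List Clause

open SetoidMembership Clauses public using () renaming (_∈_ to _∈ᶜ_)

varsCNF : CNF → List Var
varsCNF = concatMap (λ C → vars (literals C))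

⊥ᶜ : Clause
⊥ᶜ = clause [] λ { (_ , () , _) }

unit : Literal → Clause
unit p = clause [ p ] λ { (_ , here refl , here ()) }

IsUnit : Clause → Set
IsUnit C = ∃[ p ] literals C ∼[ set ] [ p ]

-- C is the resolvent of D = A ∪ {x} and E = B ∪ {x̄} on x.  That A ∪ B is a
-- clause holds because C is one.
IsResolvent : Var → Clause → Clause → Clause → Set
IsResolvent x D E C = ∃[ A ] ∃[ B ]
  ( x ∉ vars A × x ∉ vars B
  × literals D ∼[ set ] (pos x ∷ A)
  × literals E ∼[ set ] (neg x ∷ B)
  × literals C ∼[ set ] (A ++ B))

IsWeakening : Clause → Clause → Set
IsWeakening A C = ∃[ B ] literals C ∼[ set ] (literals A ++ B)

-- A rule R says which clauses may be added to the current CNF.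
Rule : Set₁
Rule = CNF → Clause → Set

WeakeningRule : Rule
WeakeningRule Γ C = ∃[ A ] (A ∈ᶜ Γ × IsWeakening A C)

Resolution : Rule
Resolution Γ C =
    (∃[ x ] ∃[ D ] ∃[ E ] (D ∈ᶜ Γ × E ∈ᶜ Γ × IsResolvent x D E C))
  ⊎ WeakeningRule Γ C

UnitPropagation : Rule
UnitPropagation Γ C =
    (∃[ x ] ∃[ D ] ∃[ E ]
      (D ∈ᶜ Γ × E ∈ᶜ Γ × (IsUnit D ⊎ IsUnit E) × IsResolvent x D E C))
  ⊎ WeakeningRule Γ C

-- Derivation R Γ Δ N is a sequence of N CNFs from Γ to Δ, each obtained from
-- its predecessor by adding one clause permitted by R.
data Derivation (R : Rule) (Γ : CNF) : CNF → ℕ → Set where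
  start : Derivation R Γ Γ 1
  step  : ∀ {Δ N} → Derivation R Γ Δ N →
          (C : Clause) → R Δ C → Derivation R Γ (C ∷ Δ) (suc N)

-- Refutations of Γ of size N.
Proof : Rule → CNF → ℕ → Set
Proof R Γ N = ∃[ Δ ] (Derivation R Γ Δ N × ⊥ᶜ ∈ᶜ Δ)

-- Refutations without new variables.  The last CNF Δ includes all earlier
-- ones, so it suffices to restrict the variables of Δ.
Proof⁻ : Rule → CNF → ℕ → Set
Proof⁻ R Γ N =
  ∃[ Δ ] (Derivation R Γ Δ N × ⊥ᶜ ∈ᶜ Δ × varsCNF Δ ⊆ varsCNF Γ)

infix 4 _⊢₁_
_⊢₁_ : CNF → Literals → Set
Γ ⊢₁ L = ∃[ N ] Proof UnitPropagation (map unit (complAll L) ++ Γ) N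

IsRATFor : Literal → CNF → Clause → Set
IsRATFor p Γ C = ∃[ C′ ]
  ( var p ∉ vars C′
  × literals C ∼[ set ] (p ∷ C′)
  × (∀ D D′ → D ∈ᶜ Γ → var p ∉ vars D′ →
       literals D ∼[ set ] (compl p ∷ D′) → Γ ⊢₁ (C′ ++ D′)))

IsRAT : CNF → Clause → Set
IsRAT Γ C = ∃[ p ] (p ∈ literals C × IsRATFor p Γ C)

IsSBCFor : Literals → CNF → Clause → Set
IsSBCFor L Γ C =
    L ≢ []
  × L ⊆ literals C
  × (∀ D → D ∈ᶜ Γ →
       (∃[ p ] (p ∈ literals D × p ∈ complAll L)) →
       Disjoint (literals D) L →
       Tautological ((literals C ∖ L) ++ (literals D ∖ complAll L)))

IsSBC : CNF → Clause → Set
IsSBC Γ C = ∃[ L ] IsSBCFor L Γ C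

RAT : Rule
RAT Γ C = Resolution Γ C ⊎ IsRAT Γ C

SBC : Rule
SBC Γ C = Resolution Γ C ⊎ IsSBC Γ C

-- s(n) = n^O(1).
IsPolynomial : (ℕ → ℕ) → Set
IsPolynomial s = ∃[ k ] ∃[ n₀ ] (∀ n → n₀ ≤ n → s n ≤ n ^ k)

AdmitsPolynomialSize : (ℕ → ℕ → Set) → Set
AdmitsPolynomialSize P =
  ∃[ s ] (IsPolynomial s × (∀ n → 1 ≤ n → P n (s n)))

-- Every size N with P n N is at least 2^(δn) for some fixed δ > 0 and all large
-- n.  Without loss of generality δ = 1/d with d a positive integer, and
-- N ≥ 2^(n/d) is written as 2^n ≤ N^d.
RequiresExponentialSize : (ℕ → ℕ → Set) → Set
RequiresExponentialSize P =
  ∃[ d ] (1 ≤ d × ∃[ n₀ ] (∀ n → n₀ ≤ n → ∀ N → P n N → 2 ^ n ≤ N ^ d))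

{-# OPTIONS --safe #-}

-- The formula states a contradictory parity (Tseitin) condition on an m × m grid.
-- Every edge is split into two variables to be summed, there are further variables
-- that no constraint mentions, and each variable p has a twin q with clauses
-- {p̄, q} and {q̄, p}.
--
-- Twins make RAT useless: the RAT condition on p for the clause {p̄, q} already
-- makes the new clause a consequence by unit propagation.  For the lower bound,
-- fix one of the two copies of each edge on row i and on column i, the choice
-- depending only on i.  A clause touching all m rows (or columns) stays unsatisfied
-- for a fraction of at most (3/4)^m of the choices, so if N is below (4/3)^m then
-- one choice satisfies all such clauses, one for each proof step.  The other
-- clauses are true in every assignment that violates only one vertex and whose row
-- and column they do not touch: the violated vertex can always be moved along its
-- row or column to get out of the way of a literal.  The empty clause is not true.
--
-- Set-blocked clauses on {z, z'} see no obstacle in the twin clauses of z, so the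
-- free variables can be defined as in extended resolution.  With the parities of
-- the initial segments of the edges between consecutive rows at hand, the grid is
-- summed up by local inferences on boundedly many variables.
module Submission where

open import Defs
open import Data.Bool.Base using (Bool; true; false; not; _xor_; _∧_; T; if_then_else_)
open import Data.Bool.Properties
  using (not-involutive; ¬-not; xor-same; xor-assoc; xor-comm; xor-identityʳ; ∧-zeroʳ; ∧-comm)
  renaming (_≟_ to _≟ᵇ_)
open import Data.Bool.Solver using (module xor-∧-Solver)
open import Data.List.Base
  using (List; []; _∷_; _++_; [_]; map; concatMap; filter; length; upTo; cartesianProductWith)
import Data.List.Membership.DecPropositional as DecMembership
open import Data.List.Membership.Propositional using (_∈_; _∉_; lose; find)
open import Data.List.Membership.Propositional.Properties
open import Data.List.Properties using (length-++)
open import Data.List.Relation.Binary.BagAndSetEquality using (_∼[_]_; set)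
open import Data.List.Relation.Binary.Disjoint.Propositional using (Disjoint)
open import Data.List.Relation.Binary.Subset.Propositional using (_⊆_)
open import Data.List.Relation.Binary.Subset.Propositional.Properties using (⊆-reflexive)
open import Data.List.Relation.Unary.All as All using (All; []; _∷_)
open import Data.List.Relation.Unary.All.Properties using (¬All⇒Any¬)
open import Data.List.Relation.Unary.Any as Any using (Any; here; there; any?)
open import Data.Nat.Base
  using (ℕ; zero; suc; _+_; _*_; _^_; _<_; _≤_; _≡ᵇ_; _<ᵇ_; _≤ᵇ_; s≤s; z≤n; s≤s⁻¹)
import Data.Nat.Properties as ℕ
open import Data.Nat.Solver using (module +-*-Solver)
open import Data.Product.Base using (Σ-syntax; ∃-syntax; _×_; _,_; proj₁; proj₂)
open import Data.Product.Properties using (≡-dec)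
open import Data.Sum.Base using (_⊎_; inj₁; inj₂; [_,_]′)
open import Data.Unit.Base using (⊤; tt)
open import Function.Base using (_∘_; id)
open import Function.Bundles using (Equivalence; mk⇔)
open import Relation.Binary.PropositionalEquality
  using (_≡_; _≢_; refl; cong; cong₂; sym; trans; subst; subst₂; module ≡-Reasoning)
open import Relation.Nullary using (contradiction; yes; no; ¬_; ¬?; Dec; does)
open import Relation.Nullary.Decidable using (decidable-stable)
open import Relation.Unary using (Decidable)

private variable
  Γ Δ Θ : CNF
  C D E U : Literals
  m N : ℕ

-- Input resolution, unit propagation and RAT

compl-involutive : ∀ p → compl (compl p) ≡ p
compl-involutive (pos _) = refl
compl-involutive (neg _) = refl

∼⇒⊆ : ∀ {C D : Literals} → C ∼[ set ] D → C ⊆ D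
∼⇒⊆ C∼D = Equivalence.to C∼D

∼⇒⊇ : C ∼[ set ] D → D ⊆ C
∼⇒⊇ C∼D = Equivalence.from C∼D

∈ᶜ⇒∈ : ∀ D → D ∈ᶜ Γ →
       ∃[ E ] (E ∈ Γ × literals D ⊆ literals E × literals E ⊆ literals D)
∈ᶜ⇒∈ D D∈Γ with find D∈Γ
... | E , E∈Γ , D∼E = E , E∈Γ , ∼⇒⊆ D∼E , ∼⇒⊇ D∼E

∈⇒∈ᶜ : ∀ {D} → D ∈ Γ → D ∈ᶜ Γ
∈⇒∈ᶜ = Any.map λ { refl → mk⇔ id id }

∷⁺-⊆ : ∀ {p} → C ⊆ D → p ∷ C ⊆ p ∷ D
∷⁺-⊆ C⊆D (here refl) = here refl
∷⁺-⊆ C⊆D (there q∈C) = there (C⊆D q∈C)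

-- An input resolution derivation of C from Δ, read upwards from C: the clauses
-- C ⊆ p ∷ C ⊆ q ∷ p ∷ C ⊆ … on its spine increase.
data Input (Δ : CNF) (C : Literals) : Set where
  taut : ∀ {p} → p ∈ C → compl p ∈ C → Input Δ C
  leaf : ∀ {D} → D ∈ Δ → literals D ⊆ C → Input Δ C
  node : ∀ {D} p → D ∈ Δ → literals D ⊆ compl p ∷ C →
         Input Δ (p ∷ C) → Input Δ C

Input-weaken : C ⊆ D → Input Δ C → Input Δ D
Input-weaken C⊆D (taut p∈C p̄∈C)     = taut (C⊆D p∈C) (C⊆D p̄∈C)
Input-weaken C⊆D (leaf E∈Δ E⊆C)     = leaf E∈Δ (C⊆D ∘ E⊆C)
Input-weaken C⊆D (node p E∈Δ E⊆ in₁) =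
  node p E∈Δ (∷⁺-⊆ C⊆D ∘ E⊆) (Input-weaken (∷⁺-⊆ C⊆D) in₁)

-- While unit propagation runs from the complements of L, the literals of S are
-- those known to be false; every clause derived so far is either true or, up
-- to literals of S, contains a clause of Δ.
Explained : CNF → Literals → Literals → Set
Explained Δ S C = (∃[ D ] (D ∈ Δ × literals D ⊆ C ++ S)) ⊎ (∃[ p ] (p ∈ C × compl p ∈ S))

⊆-++-elim : C ⊆ D ++ E → D ⊆ U → E ⊆ U → C ⊆ U
⊆-++-elim {D = D} C⊆ D⊆ S⊆ p∈C with ∈-++⁻ D (C⊆ p∈C)
... | inj₁ p∈D = D⊆ p∈D
... | inj₂ p∈S = S⊆ p∈S

Explained-mono : ∀ {S T} → S ⊆ T → C ⊆ D → Explained Δ S C → Explained Δ T D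
Explained-mono {C} {D} S⊆T C⊆D (inj₁ (E , E∈Δ , E⊆)) =
  inj₁ (E , E∈Δ , ⊆-++-elim {D = C} E⊆ (∈-++⁺ˡ ∘ C⊆D) (∈-++⁺ʳ D ∘ S⊆T))
Explained-mono S⊆T C⊆D (inj₂ (p , p∈C , p̄∈S)) = inj₂ (p , C⊆D p∈C , S⊆T p̄∈S)

Explained-resolve : ∀ {S} p → compl p ∈ S → E ⊆ compl p ∷ C → Explained Δ S E →
                    Input Δ S ⊎ Explained Δ S C
Explained-resolve {E} {C} {S = S} p p̄∈S E⊆ (inj₁ (D , D∈Δ , D⊆)) =
  inj₂ (inj₁ (D , D∈Δ , ⊆-++-elim {D = E} D⊆ (drop ∘ E⊆) (∈-++⁺ʳ C)))
  where
  drop : compl p ∷ C ⊆ C ++ S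
  drop (here refl) = ∈-++⁺ʳ C p̄∈S
  drop (there q∈C) = ∈-++⁺ˡ q∈C
Explained-resolve p p̄∈S E⊆ (inj₂ (q , q∈E , q̄∈S)) with E⊆ q∈E
-- A literal and its complement are both recorded as false: the top of the spine is tautological and
-- propagation ends.
... | here refl = inj₁ (taut p̄∈S q̄∈S)
... | there q∈C = inj₂ (inj₂ (q , q∈C , q̄∈S))

-- S is the current top of the spine, and the function from `Input Δ S` is the part of the spine
-- built so far. The first alternative is a spine that is already complete.
Extension : CNF → Literals → (Literals → Set) → Set
Extension Δ L P = Input Δ L ⊎ (∃[ S ] (L ⊆ S × (Input Δ S → Input Δ L) × P S))

Explained-unit : ∀ {S} p → U ⊆ [ p ] → E ⊆ compl p ∷ C →
                 Explained Δ S U → Explained Δ S E →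
                 Extension Δ S (λ T → Explained Δ T C)
Explained-unit {C = C} {S = S} p U⊆ E⊆ (inj₂ (q , q∈U , q̄∈S)) ex with U⊆ q∈U
... | here refl with Explained-resolve p q̄∈S E⊆ ex
...   | inj₁ in₁ = inj₁ in₁
...   | inj₂ ex′ = inj₂ (S , id , id , ex′)
Explained-unit {U} {Δ = Δ} {S = S} p U⊆ E⊆ (inj₁ (D , D∈Δ , D⊆)) ex =
  conclude (Explained-resolve p (here refl) E⊆ (Explained-mono there id ex))
  where
  D⊆p∷S : literals D ⊆ p ∷ S
  D⊆p∷S = ⊆-++-elim {D = U} D⊆ (∈-++⁺ˡ {ys = S} ∘ U⊆) there

  extend : Input Δ (compl p ∷ S) → Input Δ S
  extend = node (compl p) D∈Δ
    (subst (λ q → literals D ⊆ q ∷ S) (sym (compl-involutive p)) D⊆p∷S)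

  conclude : Input Δ (compl p ∷ S) ⊎ Explained Δ (compl p ∷ S) _ → Extension Δ S _
  conclude (inj₁ in₁) = inj₁ (extend in₁)
  conclude (inj₂ ex′) = inj₂ (compl p ∷ S , there , extend , ex′)

pivot-unit : ∀ {p q} → C ∼[ set ] (p ∷ D) → C ∼[ set ] [ q ] → C ⊆ [ p ]
pivot-unit C∼pD C∼q r∈C with ∼⇒⊆ C∼q r∈C | ∼⇒⊆ C∼q (∼⇒⊇ C∼pD (here refl))
... | here refl | here refl = here refl

-- Induction along the propagation, starting from S = L: the added units are true there and the
-- clauses of Δ explain themselves. A resolution step extends the spine by at most one node.
unit-propagation⇒Input : ∀ {L} →
  Derivation UnitPropagation (map unit (complAll L) ++ Δ) Θ N →
  Extension Δ L (λ S → ∀ {C} → C ∈ Θ → Explained Δ S (literals C))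
unit-propagation⇒Input {Δ} {L = L} start = inj₂ (L , id , id , initial)
  where
  initial : ∀ {C} → C ∈ map unit (complAll L) ++ Δ → Explained Δ L (literals C)
  initial C∈ with ∈-++⁻ (map unit (complAll L)) C∈
  ... | inj₂ C∈Δ = inj₁ (_ , C∈Δ , ∈-++⁺ˡ)
  ... | inj₁ C∈units with ∈-map⁻ unit C∈units
  ...   | q , q∈ , refl with ∈-map⁻ compl q∈
  ...     | p , p∈L , refl =
    inj₂ (compl p , here refl , subst (_∈ L) (sym (compl-involutive p)) p∈L)
unit-propagation⇒Input {Δ} {L = L} (step {Δ = Θ} der C rule)
  with unit-propagation⇒Input der
... | inj₁ in₁ = inj₁ in₁
... | inj₂ (S , L⊆S , to-L , explained) = add rule
  where
  at : ∀ D → D ∈ᶜ Θ → Explained Δ S (literals D)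
  at D D∈Θ with ∈ᶜ⇒∈ D D∈Θ
  ... | _ , E∈Θ , _ , E⊆D = Explained-mono id E⊆D (explained E∈Θ)

  conclude : Extension Δ S (λ T → Explained Δ T (literals C)) →
             Extension Δ L (λ T → ∀ {D} → D ∈ C ∷ Θ → Explained Δ T (literals D))
  conclude (inj₁ in₁) = inj₁ (to-L in₁)
  conclude (inj₂ (T , S⊆T , to-S , ex)) = inj₂ (T , S⊆T ∘ L⊆S , to-L ∘ to-S , λ
    { (here refl) → ex ; (there D∈Θ) → Explained-mono S⊆T id (explained D∈Θ) })

  add : UnitPropagation Θ C →
        Extension Δ L (λ T → ∀ {D} → D ∈ C ∷ Θ → Explained Δ T (literals D))
  add (inj₂ (D , D∈Θ , B , C∼)) =
    conclude (inj₂ (S , id , id , Explained-mono id (∼⇒⊇ C∼ ∘ ∈-++⁺ˡ {ys = B}) (at D D∈Θ)))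
  add (inj₁ (x , D , E , D∈Θ , E∈Θ , inj₁ (_ , D∼q) , A , B , _ , _ , D∼ , E∼ , C∼)) =
    conclude (Explained-unit (pos x) (pivot-unit D∼ D∼q)
      (∷⁺-⊆ (∼⇒⊇ C∼ ∘ ∈-++⁺ʳ A) ∘ ∼⇒⊆ E∼) (at D D∈Θ) (at E E∈Θ))
  add (inj₁ (x , D , E , D∈Θ , E∈Θ , inj₂ (_ , E∼q) , A , B , _ , _ , D∼ , E∼ , C∼)) =
    conclude (Explained-unit (neg x) (pivot-unit E∼ E∼q)
      (∷⁺-⊆ (∼⇒⊇ C∼ ∘ ∈-++⁺ˡ {ys = B}) ∘ ∼⇒⊆ D∼) (at E E∈Θ) (at D D∈Θ))

-- The empty clause has no true literal, so its explanation is a clause of Δ inside S, which closes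
-- the spine with a leaf.
⊢₁⇒Input : ∀ {L} → Δ ⊢₁ L → Input Δ L
⊢₁⇒Input (_ , Θ , der , ⊥∈Θ) with unit-propagation⇒Input der
... | inj₁ in₁ = in₁
... | inj₂ (S , L⊆S , to-L , explained) with ∈ᶜ⇒∈ ⊥ᶜ ⊥∈Θ
...   | E , E∈Θ , _ , E⊆[] with Explained-mono id E⊆[] (explained E∈Θ)
...     | inj₁ (D , D∈Δ , D⊆S) = to-L (leaf D∈Δ D⊆S)

Resolution⇒Input : ∀ C → Resolution Δ C → Input Δ (literals C)
Resolution⇒Input C (inj₂ (D , D∈Δ , B , C∼)) with ∈ᶜ⇒∈ D D∈Δ
... | _ , E∈Δ , _ , E⊆D = leaf E∈Δ (∼⇒⊇ C∼ ∘ ∈-++⁺ˡ {ys = B} ∘ E⊆D)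
Resolution⇒Input C (inj₁ (x , D , E , D∈Δ , E∈Δ , A , B , _ , _ , D∼ , E∼ , C∼))
  with ∈ᶜ⇒∈ D D∈Δ | ∈ᶜ⇒∈ E E∈Δ
... | _ , D′∈Δ , _ , D′⊆D | _ , E′∈Δ , _ , E′⊆E =
  node (pos x) E′∈Δ (∷⁺-⊆ (∼⇒⊇ C∼ ∘ ∈-++⁺ʳ A) ∘ ∼⇒⊆ E∼ ∘ E′⊆E)
    (leaf D′∈Δ (∷⁺-⊆ (∼⇒⊇ C∼ ∘ ∈-++⁺ˡ {ys = B}) ∘ ∼⇒⊆ D∼ ∘ D′⊆D))

-- The first clause is given exactly, because the RAT condition speaks of clauses of that form; the
-- second is a side premise of a node, where inclusion is enough.
HasTwin : CNF → Literal → Set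
HasTwin Γ p = ∃[ q ] (var p ≢ var q ×
  (∃[ D ] (D ∈ Γ × literals D ∼[ set ] (compl p ∷ [ q ]))) ×
  (∃[ D ] (D ∈ Γ × literals D ⊆ compl q ∷ [ p ])))

-- On the twin clause {p̄, q} the RAT condition says that C′ ∪ {q} follows by unit
-- propagation, and resolving with {q̄, p} turns q into p.
RATFor⇒Input : ∀ p C → HasTwin Δ p → IsRATFor p Δ C → Input Δ (literals C)
RATFor⇒Input p C (q , p≢q , (D , D∈Δ , D∼) , E , E∈Δ , E⊆) (C′ , _ , C∼ , rat) =
  node q E∈Δ (λ r∈E → relax (E⊆ r∈E))
    (Input-weaken merge (⊢₁⇒Input (rat D [ q ] (∈⇒∈ᶜ D∈Δ) (λ { (here eq) → p≢q eq }) D∼)))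
  where
  relax : compl q ∷ [ p ] ⊆ compl q ∷ literals C
  relax (here refl)         = here refl
  relax (there (here refl)) = there (∼⇒⊇ C∼ (here refl))
  merge : C′ ++ [ q ] ⊆ q ∷ literals C
  merge r∈ with ∈-++⁻ C′ r∈
  ... | inj₁ r∈C′        = there (∼⇒⊇ C∼ (there r∈C′))
  ... | inj₂ (here refl) = here refl

-- Parity equations

Assignment : Set
Assignment = Var → Bool

⟦_⟧ : Literal → Assignment → Bool
⟦ pos v ⟧ α = α v
⟦ neg v ⟧ α = not (α v)

literal : Bool → Var → Literal
literal true  v = pos v
literal false v = neg v

falseLiteral : Assignment → Var → Literal
falseLiteral α v = literal (not (α v)) v

falsified : Assignment → List Var → Literals
falsified α = map (falseLiteral α)

var-literal : ∀ b v → var (literal b v) ≡ v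
var-literal true  v = refl
var-literal false v = refl

literal-true : ∀ b v α → α v ≡ b → ⟦ literal b v ⟧ α ≡ true
literal-true true  v α eq = eq
literal-true false v α eq = cong not eq

⟦compl⟧ : ∀ p α → ⟦ compl p ⟧ α ≡ not (⟦ p ⟧ α)
⟦compl⟧ (pos v) α = refl
⟦compl⟧ (neg v) α = sym (not-involutive (α v))

vars-falsified : ∀ α vs → vars (falsified α vs) ≡ vs
vars-falsified α []       = refl
vars-falsified α (v ∷ vs) = cong₂ _∷_ (var-literal (not (α v)) v) (vars-falsified α vs)

falseLiteral-cong : ∀ {α β : Assignment} v → α v ≡ β v → falseLiteral α v ≡ falseLiteral β v
falseLiteral-cong v eq = cong (λ b → literal (not b) v) eq

falsified-cong : ∀ {α β : Assignment} vs → (∀ {v} → v ∈ vs → α v ≡ β v) →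
                 falsified α vs ≡ falsified β vs
falsified-cong []       eq = refl
falsified-cong {α} {β} (v ∷ vs) eq =
  cong₂ _∷_ (falseLiteral-cong {α} {β} v (eq (here refl))) (falsified-cong vs (eq ∘ there))

xor-false⇒≡ : ∀ a b → a xor b ≡ false → a ≡ b
xor-false⇒≡ false false _ = refl
xor-false⇒≡ true  true  _ = refl

xor-true⇒≡not : ∀ a b → a xor b ≡ true → a ≡ not b
xor-true⇒≡not true  false _ = refl
xor-true⇒≡not false true  _ = refl

parity : Assignment → List Var → Bool
parity α []       = false
parity α (v ∷ vs) = α v xor parity α vs

parity-cong : ∀ {α β : Assignment} vs → (∀ {v} → v ∈ vs → α v ≡ β v) → parity α vs ≡ parity β vs
parity-cong []       eq = refl
parity-cong (v ∷ vs) eq = cong₂ _xor_ (eq (here refl)) (parity-cong vs (eq ∘ there))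

falsified-⟦⟧ : ∀ {α p} vs → p ∈ falsified α vs → ⟦ p ⟧ α ≡ false
falsified-⟦⟧ {α} vs p∈ with ∈-map⁻ (falseLiteral α) p∈
... | v , _ , refl with α v in eq
...   | true  = cong not eq
...   | false = eq

falsified-clause : Assignment → List Var → Clause
falsified-clause α vs = clause (falsified α vs) λ (v , p∈ , n∈) →
  contradiction (trans (sym (falsified-⟦⟧ vs p∈)) (trans (sym (not-involutive (α v)))
    (cong not (falsified-⟦⟧ vs n∈)))) λ ()

_[_≔_] : Assignment → Var → Bool → Assignment
(α [ v ≔ b ]) w with w ℕ.≟ v
... | yes _ = b
... | no  _ = α w

≔-same : ∀ α v b → (α [ v ≔ b ]) v ≡ b
≔-same α v b with v ℕ.≟ v
... | yes _  = refl
... | no v≢v = contradiction refl v≢v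

≔-other : ∀ α {v w} b → w ≢ v → (α [ v ≔ b ]) w ≡ α w
≔-other α {v} {w} b w≢v with w ℕ.≟ v
... | yes w≡v = contradiction w≡v w≢v
... | no _    = refl

assignments : List Var → List Assignment
assignments []       = [ (λ _ → false) ]
assignments (v ∷ vs) = concatMap (λ α → (α [ v ≔ false ]) ∷ [ α [ v ≔ true ] ]) (assignments vs)

assignments-complete : ∀ (α : Assignment) vs →
  Σ[ β ∈ Assignment ] (β ∈ assignments vs × (∀ {v} → v ∈ vs → β v ≡ α v))
assignments-complete α []       = _ , here refl , λ ()
assignments-complete α (v ∷ vs) with assignments-complete α vs
... | β , β∈ , β≡α = β [ v ≔ α v ] , ∈-concatMap⁺ _ (lose β∈ (choose (α v))) , agree
  where
  choose : ∀ b → (β [ v ≔ b ]) ∈ (β [ v ≔ false ]) ∷ [ β [ v ≔ true ] ]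
  choose false = here refl
  choose true  = there (here refl)
  agree : ∀ {w} → w ∈ v ∷ vs → (β [ v ≔ α v ]) w ≡ α w
  agree {w} w∈ with w ℕ.≟ v
  ... | yes refl = refl
  agree (here refl) | no w≢v = contradiction refl w≢v
  agree (there w∈)  | no w≢v = β≡α w∈

-- (vs , b) stands for the equation that the variables vs sum to b modulo 2.
Equation : Set
Equation = List Var × Bool

abstract
  clauses : Equation → CNF
  clauses (vs , b) = map (λ α → falsified-clause α vs)
    (filter (λ α → ¬? (parity α vs ≟ᵇ b)) (assignments vs))

  ∈-clauses⁻ : ∀ {C} vs b → C ∈ clauses (vs , b) →
    Σ[ α ∈ Assignment ] (C ≡ falsified-clause α vs × parity α vs ≢ b)
  ∈-clauses⁻ vs b C∈ with ∈-map⁻ (λ α → falsified-clause α vs) C∈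
  ... | α , α∈ , refl = α , refl ,
    proj₂ (∈-filter⁻ (λ α → ¬? (parity α vs ≟ᵇ b)) {xs = assignments vs} α∈)

  clauses-complete : ∀ α vs b → parity α vs ≢ b →
    ∃[ C ] (C ∈ clauses (vs , b) × literals C ≡ falsified α vs)
  clauses-complete α vs b odd with assignments-complete α vs
  ... | β , β∈ , β≡α = falsified-clause β vs ,
    ∈-map⁺ (λ α → falsified-clause α vs)
      (∈-filter⁺ (λ α → ¬? (parity α vs ≟ᵇ b)) β∈ (odd ∘ trans (sym (parity-cong {β} {α} vs β≡α)))) ,
    falsified-cong {β} {α} vs β≡α

-- Local entailment: each violation is refuted by a single clause. The list `ws` may exceed the
-- variables of the equation by variables that resolution has yet to eliminate.
Refutes : CNF → List Var → Equation → Set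
Refutes Γ ws (vs , b) =
  ∀ α → parity α vs ≢ b → ∃[ C ] (C ∈ Γ × literals C ⊆ falsified α ws)

infix 4 _⊩_
_⊩_ : CNF → Equation → Set
Γ ⊩ e = Refutes Γ (proj₁ e) e

clauses-⊩ : ∀ e → clauses e ⊆ Γ → Γ ⊩ e
clauses-⊩ (vs , b) ⊆Γ α odd with clauses-complete α vs b odd
... | C , C∈ , eq = C , ⊆Γ C∈ , subst (_ ∈_) eq

-- The grid formula

data Name : Set where
  edge : (direction : Bool) (line position : ℕ) (copy : Bool) → Name
  aux  : ℕ → ℕ → Name

-- The number 2n + b, that is, n with b appended as its lowest bit.
push : Bool → ℕ → ℕ
push b     (suc n) = suc (suc (push b n))
push false zero    = 0
push true  zero    = 1

pop : ℕ → Bool × ℕ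
pop 0             = false , 0
pop 1             = true , 0
pop (suc (suc n)) = let b , m = pop n in b , suc m

pop-push : ∀ b n → pop (push b n) ≡ (b , n)
pop-push false zero    = refl
pop-push true  zero    = refl
pop-push b     (suc n) rewrite pop-push b n = refl

triangle : ℕ → ℕ
triangle zero    = 0
triangle (suc s) = suc (s + triangle s)

-- Cantor pairing. `next` walks along the antidiagonals, so `unpair` counts steps from the origin.
pair : ℕ → ℕ → ℕ
pair a b = b + triangle (a + b)

next : ℕ × ℕ → ℕ × ℕ
next (zero  , b) = suc b , 0
next (suc a , b) = a , suc b

unpair : ℕ → ℕ × ℕ
unpair zero    = 0 , 0
unpair (suc n) = next (unpair n)

-- Induction on the antidiagonal s and on b within it; at b = 0 the predecessor is the last pair of
-- the previous antidiagonal.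
unpair-pair : ∀ s a b → a + b ≡ s → unpair (b + triangle s) ≡ (a , b)
unpair-pair s       a (suc b) refl = cong next
  (unpair-pair (a + suc b) (suc a) b (sym (ℕ.+-suc a b)))
unpair-pair zero    zero    zero eq   = refl
unpair-pair (suc s) (suc a) zero refl = cong next (trans
  (cong (λ x → unpair (x + triangle (a + 0))) (ℕ.+-identityʳ a))
  (unpair-pair (a + 0) 0 a (sym (ℕ.+-identityʳ a))))

-- The Boolean tells the two twins of a variable apart.
abstract
  encode : Name → Bool → Var
  encode (aux x y)      t = push t (push false (pair x y))
  encode (edge d i k c) t = push t (push true (push d (push c (pair i k))))

  decode : Var → Name × Bool
  decode v with pop v
  ... | t , v₁ with pop v₁
  ...   | false , v₂ = let x , y = unpair v₂ in aux x y , t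
  ...   | true  , v₂ with pop v₂
  ...     | d , v₃ with pop v₃
  ...       | c , v₄ = let i , k = unpair v₄ in edge d i k c , t

  decode-encode : ∀ n t → decode (encode n t) ≡ (n , t)
  decode-encode (aux x y) t
    rewrite pop-push t (push false (pair x y)) | pop-push false (pair x y)
          | unpair-pair (x + y) x y refl = refl
  decode-encode (edge d i k c) t
    rewrite pop-push t (push true (push d (push c (pair i k))))
          | pop-push true (push d (push c (pair i k))) | pop-push d (push c (pair i k))
          | pop-push c (pair i k) | unpair-pair (i + k) i k refl = refl

encode-injective : ∀ {n n′ t t′} → encode n t ≡ encode n′ t′ → (n , t) ≡ (n′ , t′)
encode-injective {n} {n′} {t} {t′} eq =
  trans (sym (decode-encode n t)) (trans (cong decode eq) (decode-encode n′ t′))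

row column : Bool
row    = false
column = true

-- Vertex (x , y) of the grid lies on row x and on column y.  Position k of a row
-- or a column is the edge entering its k-th vertex.
data Site : Set where
  vertex    : ℕ → ℕ → Site
  boundary  : (direction : Bool) (line position : ℕ) → Bool → Site
  auxiliary : ℕ → ℕ → Site

edgePair : Bool → ℕ → ℕ → List Name
edgePair d i k = edge d i k false ∷ [ edge d i k true ]

names : Site → List Name
names (vertex x y)       = edgePair row x y ++ edgePair row x (suc y) ++
                           edgePair column y x ++ edgePair column y (suc x)
names (boundary d i k b) = edgePair d i k
names (auxiliary x y)    = [ aux x y ]

unprimed : List Name → List Var
unprimed = map (λ n → encode n false)

twins : Name → Equation
twins n = encode n false ∷ [ encode n true ] , false

equations : Site → List Equation
equations s@(vertex x y)       = [ unprimed (names s) , false ]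
equations s@(boundary d i k b) = [ unprimed (names s) , b ]
equations (auxiliary x y)      = []

block : Site → CNF
block s = concatMap clauses (equations s) ++ concatMap (clauses ∘ twins) (names s)

-- The only odd boundary value enters on column 0; it makes the system contradictory.
source : Bool → ℕ → Bool
source d i = d ∧ (i ≡ᵇ 0)

vertexSites sourceSites sinkSites auxiliarySites sites : ℕ → List Site
vertexSites m    = cartesianProductWith vertex (upTo m) (upTo m)
sourceSites m    =
  cartesianProductWith (λ d i → boundary d i 0 (source d i)) (row ∷ [ column ]) (upTo m)
sinkSites m      =
  cartesianProductWith (λ d i → boundary d i m false) (row ∷ [ column ]) (upTo m)
-- Both coordinates include m: there are column edges leaving the last row, and prefixes running
-- over all columns.
auxiliarySites m = cartesianProductWith auxiliary (upTo (suc m)) (upTo (suc m))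
sites m          = vertexSites m ++ sourceSites m ++ sinkSites m ++ auxiliarySites m

abstract
  formula : ℕ → CNF
  formula m = concatMap block (sites m)

  block⊆formula : ∀ m {t} → t ∈ sites m → block t ⊆ formula m
  block⊆formula m t∈ C∈ = ∈-concatMap⁺ block (lose t∈ C∈)

  ∈-formula⁻ : ∀ m {C} → C ∈ formula m → ∃[ t ] (t ∈ sites m × C ∈ block t)
  ∈-formula⁻ m C∈ = find (∈-concatMap⁻ block {xs = sites m} C∈)

-- Restrictions hitting many clauses

Choice : Set
Choice = Bool × Bool

_≟ᶜ_ : (c c′ : Choice) → Dec (c ≡ c′)
_≟ᶜ_ = ≡-dec _≟ᵇ_ _≟ᵇ_

missing : Choice → ℕ → List (ℕ → Choice) → List (ℕ → Choice)
missing c i = filter (λ κ → ¬? (κ i ≟ᶜ c))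

below-half : ∀ a b → (a + a ≤ a + b) ⊎ (b + b ≤ a + b)
below-half a b with ℕ.≤-total a b
... | inj₁ a≤b = inj₁ (ℕ.+-monoʳ-≤ a a≤b)
... | inj₂ b≤a = inj₂ (ℕ.+-monoˡ-≤ b b≤a)

total : (Choice → ℕ) → ℕ
total f = (f (false , false) + f (false , true)) + (f (true , false) + f (true , true))

total-+ : ∀ f g → total (λ c → f c + g c) ≡ total f + total g
total-+ f g = solve 8 (λ a b c d a′ b′ c′ d′ →
    ((a :+ a′) :+ (b :+ b′)) :+ ((c :+ c′) :+ (d :+ d′))
    := ((a :+ b) :+ (c :+ d)) :+ ((a′ :+ b′) :+ (c′ :+ d′))) refl
  (f (false , false)) (f (false , true)) (f (true , false)) (f (true , true))
  (g (false , false)) (g (false , true)) (g (true , false)) (g (true , true))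
  where open +-*-Solver

below-average : ∀ f → ∃[ c ] 4 * f c ≤ total f
below-average f with below-half (f (false , false)) (f (false , true))
                   | below-half (f (true , false)) (f (true , true))
... | x | y = combine (half false x) (half true y)
  where
  half : ∀ s → let u = f (s , false) ; v = f (s , true) in
         (u + u ≤ u + v) ⊎ (v + v ≤ u + v) → ∃[ b ] f (s , b) + f (s , b) ≤ u + v
  half s (inj₁ le) = false , le
  half s (inj₂ le) = true , le

  regroup : ∀ x y → (x + y) + (x + y) ≡ (x + x) + (y + y)
  regroup = solve 2 (λ x y → (x :+ y) :+ (x :+ y) := (x :+ x) :+ (y :+ y)) refl
    where open +-*-Solver

  quadruple : ∀ x → 4 * x ≡ (x + x) + (x + x)
  quadruple = solve 1 (λ x → con 4 :* x := (x :+ x) :+ (x :+ x)) refl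
    where open +-*-Solver

  combine : ∃[ b ] f (false , b) + f (false , b) ≤ f (false , false) + f (false , true) →
            ∃[ b ] f (true , b) + f (true , b) ≤ f (true , false) + f (true , true) →
            ∃[ c ] 4 * f c ≤ total f
  combine (b , x≤) (b′ , y≤) = pick (below-half (f (false , b)) (f (true , b′)))
    where
    open ℕ.≤-Reasoning
    u = f (false , b)
    v = f (true , b′)
    bound : ∀ w → w + w ≤ u + v → 4 * w ≤ total f
    bound w le = begin
      4 * w               ≡⟨ quadruple w ⟩
      (w + w) + (w + w)   ≤⟨ ℕ.+-mono-≤ le le ⟩
      (u + v) + (u + v)   ≡⟨ regroup u v ⟩
      (u + u) + (v + v)   ≤⟨ ℕ.+-mono-≤ x≤ y≤ ⟩
      total f             ∎
    pick : (u + u ≤ u + v) ⊎ (v + v ≤ u + v) → ∃[ c ] 4 * f c ≤ total f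
    pick (inj₁ le) = (false , b) , bound u le
    pick (inj₂ le) = (true , b′) , bound v le

mismatch : Choice → Choice → ℕ
mismatch c′ c = if does (c′ ≟ᶜ c) then 0 else 1

mismatch-total : ∀ c → total (mismatch c) ≡ 3
mismatch-total (false , false) = refl
mismatch-total (false , true)  = refl
mismatch-total (true  , false) = refl
mismatch-total (true  , true)  = refl

missing-∷ : ∀ c i κ κs → length (missing c i (κ ∷ κs)) ≡ mismatch (κ i) c + length (missing c i κs)
missing-∷ c i κ κs with does (κ i ≟ᶜ c)
... | true  = refl
... | false = refl

missing-total : ∀ i κs → total (λ c → length (missing c i κs)) ≡ 3 * length κs
missing-total i []       = refl
missing-total i (κ ∷ κs) = begin
  total (λ c → length (missing c i (κ ∷ κs)))
    ≡⟨ cong₂ _+_ (cong₂ _+_ (missing-∷ _ i κ κs) (missing-∷ _ i κ κs))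
                 (cong₂ _+_ (missing-∷ _ i κ κs) (missing-∷ _ i κ κs)) ⟩
  total (λ c → mismatch (κ i) c + length (missing c i κs))
    ≡⟨ total-+ (mismatch (κ i)) (λ c → length (missing c i κs)) ⟩
  total (mismatch (κ i)) + total (λ c → length (missing c i κs))
    ≡⟨ cong₂ _+_ (mismatch-total (κ i)) (missing-total i κs) ⟩
  3 + 3 * length κs
    ≡⟨ ℕ.*-suc 3 (length κs) ⟨
  3 * length (κ ∷ κs) ∎
  where open ≡-Reasoning

Hits : ℕ → (ℕ → Choice) → (ℕ → Choice) → Set
Hits m ρ κ = ∃[ i ] (i < m × ρ i ≡ κ i)

-- A derandomised union bound. Each κ misses three of the four choices at a line, so some choice
-- leaves at most three quarters of `κs` unhit; the hypothesis survives this, and for m = 0 it says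
-- that none is left.
hitting : ∀ m κs → length κs * 3 ^ m < 4 ^ m → ∃[ ρ ] (∀ {κ} → κ ∈ κs → Hits m ρ κ)
hitting zero [] lt = (λ _ → false , false) , λ ()
hitting zero (κ ∷ κs) (s≤s ())
hitting (suc m) κs lt with below-average (λ c → length (missing c m κs))
... | c , 4x≤ with hitting m (missing c m κs) smaller
  where
  x = length (missing c m κs)
  open ℕ.≤-Reasoning
  smaller : x * 3 ^ m < 4 ^ m
  smaller = ℕ.*-cancelˡ-< 4 _ _ (begin-strict
    4 * (x * 3 ^ m)           ≡⟨ ℕ.*-assoc 4 x (3 ^ m) ⟨
    4 * x * 3 ^ m             ≤⟨ ℕ.*-monoˡ-≤ (3 ^ m) (subst (4 * x ≤_) (missing-total m κs) 4x≤) ⟩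
    3 * length κs * 3 ^ m     ≡⟨ cong (_* 3 ^ m) (ℕ.*-comm 3 (length κs)) ⟩
    length κs * 3 * 3 ^ m     ≡⟨ ℕ.*-assoc (length κs) 3 (3 ^ m) ⟩
    length κs * 3 ^ suc m     <⟨ lt ⟩
    4 * 4 ^ m                 ∎)
... | ρ , hit = ρ′ , hit′
  where
  ρ′ : ℕ → Choice
  ρ′ i with i ℕ.≟ m
  ... | yes _ = c
  ... | no _  = ρ i
  at-m : ρ′ m ≡ c
  at-m with m ℕ.≟ m
  ... | yes _  = refl
  ... | no m≢m = contradiction refl m≢m
  below-m : ∀ {i} → i < m → ρ′ i ≡ ρ i
  below-m {i} i<m with i ℕ.≟ m
  ... | yes refl = contradiction i<m (ℕ.n≮n i)
  ... | no _     = refl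
  hit′ : ∀ {κ} → κ ∈ κs → Hits (suc m) ρ′ κ
  hit′ {κ} κ∈κs with κ m ≟ᶜ c
  ... | yes κm≡c = m , ℕ.n<1+n m , trans at-m (sym κm≡c)
  ... | no  κm≢c with hit (∈-filter⁺ (λ κ → ¬? (κ m ≟ᶜ c)) κ∈κs κm≢c)
  ...   | i , i<m , eq = i , ℕ.m<n⇒m<1+n i<m , trans (below-m i<m) eq

-- States with one violated vertex

excess : (Bool → ℕ → ℕ → Bool) → Bool → ℕ → ℕ → Bool
excess h d i k = h d i k xor h d i (suc k)

-- Edge values that fail at one vertex only, the one on row `at row` and column `at column`. The
-- equations range over all naturals, also beyond the grid, which spares bounds on x and y.
record State (m : ℕ) : Set where
  field
    h        : Bool → ℕ → ℕ → Bool
    at       : Bool → ℕ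
    at<m     : ∀ d → at d < m
    entry    : ∀ d i → h d i 0 ≡ source d i
    exit     : ∀ d i → h d i m ≡ false
    vertices : ∀ x y → excess h row x y xor excess h column y x
                       ≡ (x ≡ᵇ at row) ∧ (y ≡ᵇ at column)

open State

-- The 1 entering on column 0 stops at vertex (0 , 0).
initial : ∀ m → State (suc m)
initial m = record
  { h        = λ d i k → (d ∧ (i ≡ᵇ 0)) ∧ (k ≡ᵇ 0)
  ; at       = λ _ → 0
  ; at<m     = λ _ → s≤s z≤n
  ; entry    = λ { false i → refl ; true zero → refl ; true (suc i) → refl }
  ; exit     = λ d i → ∧-zeroʳ _
  ; vertices = λ { zero    zero → refl ; zero    (suc _) → refl
                 ; (suc _) zero → refl ; (suc _) (suc _) → refl }
  }

-- Position k enters vertex k, so the edges on the way between vertices a and b are those with min a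
-- b < k ≤ max a b.
between : ℕ → ℕ → ℕ → Bool
between a b k = (a <ᵇ k) xor (b <ᵇ k)

<ᵇ-step : ∀ a k → (a <ᵇ k) xor (a <ᵇ suc k) ≡ (k ≡ᵇ a)
<ᵇ-step zero    zero    = refl
<ᵇ-step zero    (suc k) = refl
<ᵇ-step (suc a) zero    = refl
<ᵇ-step (suc a) (suc k) = <ᵇ-step a k

<⇒<ᵇ≡true : ∀ {a b} → a < b → (a <ᵇ b) ≡ true
<⇒<ᵇ≡true {zero}  (s≤s _)   = refl
<⇒<ᵇ≡true {suc a} (s≤s a<b) = <⇒<ᵇ≡true a<b

-- Toggling a path changes parities at its two ends only, since a threshold indicator changes value
-- only at its threshold. The bit l says whether the line is the one travelled.
toggle-excess : ∀ (g : ℕ → Bool) l a b k →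
  let g′ = λ k → g k xor (l ∧ between a b k) in
  g′ k xor g′ (suc k) ≡ (g k xor g (suc k)) xor (l ∧ ((k ≡ᵇ a) xor (k ≡ᵇ b)))
toggle-excess g l a b k = trans
  (solve 7 (λ g g′ l a a′ b b′ →
      (g :+ (l :* (a :+ b))) :+ (g′ :+ (l :* (a′ :+ b′)))
      := (g :+ g′) :+ (l :* ((a :+ a′) :+ (b :+ b′)))) refl
    (g k) (g (suc k)) l (a <ᵇ k) (a <ᵇ suc k) (b <ᵇ k) (b <ᵇ suc k))
  (cong₂ (λ u v → (g k xor g (suc k)) xor (l ∧ (u xor v))) (<ᵇ-step a k) (<ᵇ-step b k))
  where open xor-∧-Solver

moved-h : State m → Bool → ℕ → Bool → ℕ → ℕ → Bool
moved-h s d t e i k = if e xor d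
  then h s e i k xor ((i ≡ᵇ at s (not d)) ∧ between (at s d) t k)
  else h s e i k

moved-at : State m → Bool → ℕ → Bool → ℕ
moved-at s d t e = if e xor d then at s e else t

-- The violated vertex moves to line t of direction d along its line of the other
-- direction, whose edges on the way are toggled.
move : State m → Bool → ∀ t → t < m → State m
move {m} s d t t<m = record
  { h        = moved-h s d t
  ; at       = moved-at s d t
  ; at<m     = at′<m
  ; entry    = entry′
  ; exit     = exit′
  ; vertices = vertices′ d
  }
  where
  at′<m : ∀ e → moved-at s d t e < m
  at′<m e with e xor d
  ... | true  = at<m s e
  ... | false = t<m

  entry′ : ∀ e i → moved-h s d t e i 0 ≡ source e i
  entry′ e i with e xor d
  ... | true  = trans (cong (h s e i 0 xor_) (∧-zeroʳ (i ≡ᵇ at s (not d))))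
                      (trans (xor-identityʳ _) (entry s e i))
  ... | false = entry s e i

  exit′ : ∀ e i → moved-h s d t e i m ≡ false
  exit′ e i with e xor d
  -- Both ends of the path are below m, so the exit at position m is not on it.
  ... | true rewrite <⇒<ᵇ≡true (at<m s d) | <⇒<ᵇ≡true t<m =
    trans (cong (h s e i m xor_) (∧-zeroʳ (i ≡ᵇ at s (not d))))
          (trans (xor-identityʳ _) (exit s e i))
  ... | false = exit s e i

  shift-row : ∀ p q a b c → p xor q ≡ a ∧ b → p xor (q xor (b ∧ (a xor c))) ≡ c ∧ b
  shift-row p q a b c eq = trans
    (solve 5 (λ p q a b c → p :+ (q :+ (b :* (a :+ c))) := (p :+ q) :+ ((a :* b) :+ (c :* b)))
      refl p q a b c)
    (trans (cong (_xor ((a ∧ b) xor (c ∧ b))) eq)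
      (solve 3 (λ a b c → (a :* b) :+ ((a :* b) :+ (c :* b)) := c :* b) refl a b c))
    where open xor-∧-Solver

  vertices′ : ∀ d x y →
    excess (moved-h s d t) row x y xor excess (moved-h s d t) column y x ≡
    (x ≡ᵇ moved-at s d t row) ∧ (y ≡ᵇ moved-at s d t column)
  vertices′ false x y = trans
    (cong (excess (h s) row x y xor_) (toggle-excess (h s column y) (y ≡ᵇ at s column) (at s row) t x))
    (shift-row (excess (h s) row x y) (excess (h s) column y x)
      (x ≡ᵇ at s row) (y ≡ᵇ at s column) (x ≡ᵇ t) (vertices s x y))
  vertices′ true x y = trans
    (cong (_xor excess (h s) column y x) (toggle-excess (h s row x) (x ≡ᵇ at s row) (at s column) t y))
    (trans (xor-comm _ (excess (h s) column y x))
    (trans (shift-row (excess (h s) column y x) (excess (h s) row x y)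
      (y ≡ᵇ at s column) (x ≡ᵇ at s row) (y ≡ᵇ t)
      (trans (xor-comm (excess (h s) column y x) _)
        (trans (vertices s x y) (∧-comm (x ≡ᵇ at s row) (y ≡ᵇ at s column)))))
      (∧-comm (y ≡ᵇ t) (x ≡ᵇ at s row))))

-- Restricted assignments and the soundness of RAT proofs

Restriction : Set
Restriction = ℕ → Choice

-- ρ i = (c , b) sets copy c of all edges on row i and on column i to b, whence the
-- other copy carries the value of the edge up to b.
value : Restriction → State m → Name → Bool
value ρ s (edge d i k c) =
  if c xor proj₁ (ρ i) then proj₂ (ρ i) xor h s d i k else proj₂ (ρ i)
value ρ s (aux x y) = false

assignment : Restriction → State m → Assignment
assignment ρ s v = value ρ s (proj₁ (decode v))

name : Literal → Name
name p = proj₁ (decode (var p))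

sign : Literal → Bool
sign (pos _) = true
sign (neg _) = false

name-compl : ∀ p → name (compl p) ≡ name p
name-compl (pos _) = refl
name-compl (neg _) = refl

-- On the two lines through the violated vertex only fixed copies are allowed. A move toggles edges
-- on one of these lines only, so it keeps the values of clear names.
Clear : Restriction → State m → Name → Set
Clear ρ s (edge d i k c) = i ≡ at s d → c ≡ proj₁ (ρ i)
Clear ρ s (aux x y)      = ⊤

ClearClause : Restriction → State m → Literals → Set
ClearClause ρ s C = ∀ {p} → p ∈ C → Clear ρ s (name p)

True : Restriction → State m → Literals → Set
True ρ s C = ∃[ p ] (p ∈ C × ⟦ p ⟧ (assignment ρ s) ≡ true)

-- The invariant of the lower bound. The empty clause is clear in every state and true in none.
Sound : ℕ → Restriction → Literals → Set
Sound m ρ C = ∀ (s : State m) → ClearClause ρ s C → True ρ s C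

Touches : Bool → ℕ → Name → Set
Touches d i n = ∃[ k ] ∃[ c ] n ≡ edge d i k c

touches? : ∀ d i → Decidable (Touches d i)
touches? d i (aux x y) = no λ ()
touches? d i (edge e j k c) with d ≟ᵇ e | i ℕ.≟ j
... | yes refl | yes refl = yes (k , c , refl)
... | no d≢e   | _        = no λ { (_ , _ , refl) → d≢e refl }
... | yes _    | no i≢j   = no λ { (_ , _ , refl) → i≢j refl }

Untouched : Bool → ℕ → Literals → Set
Untouched d i C = ∀ {p} → p ∈ C → ¬ Touches d i (name p)

touched? : ∀ d i C → Dec (Any (Touches d i ∘ name) C)
touched? d i = any? (touches? d i ∘ name)

-- Junk unless C has a variable on line i.
satisfying : Bool → Literals → ℕ → Choice
satisfying d C i with touched? d i C
... | no _  = false , false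
... | yes t with find t
...   | p , _ , _ , c , _ = c , sign p

fixed-true : ∀ ρ (s : State m) p {d i k c} → name p ≡ edge d i k c →
             ρ i ≡ (c , sign p) → ⟦ p ⟧ (assignment ρ s) ≡ true
fixed-true ρ s p {c = c} eq ρi = go p eq ρi
  where
  go : ∀ p {d i k} → name p ≡ edge d i k c → ρ i ≡ (c , sign p) → ⟦ p ⟧ (assignment ρ s) ≡ true
  go (pos v) eq ρi rewrite eq | ρi | xor-same c = refl
  go (neg v) eq ρi rewrite eq | ρi | xor-same c = refl

fixed-clear : ∀ ρ (s : State m) {n d i k c b} → n ≡ edge d i k c → ρ i ≡ (c , b) → Clear ρ s n
fixed-clear ρ s refl ρi _ = sym (cong proj₁ ρi)

satisfying-fixes : ∀ d C i (ρ : Restriction) → Any (Touches d i ∘ name) C → ρ i ≡ satisfying d C i →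
  ∃[ p ] ∃[ k ] ∃[ c ] (p ∈ C × name p ≡ edge d i k c × ρ i ≡ (c , sign p))
satisfying-fixes d C i ρ t ρi with touched? d i C
... | no ¬t = contradiction t ¬t
... | yes t′ with find t′
...   | p , p∈C , k , c , eq = p , k , c , p∈C , eq , ρi

untouched-line : ∀ m d C → (∃[ i ] (i < m × Untouched d i C)) ⊎
                 (∀ {i} → i < m → Any (Touches d i ∘ name) C)
untouched-line m d C with ℕ.anyUpTo? (λ i → ¬? (touched? d i C)) m
... | yes (i , i<m , ¬t) = inj₁ (i , i<m , λ p∈C t → ¬t (lose p∈C t))
... | no all = inj₂ λ {i} i<m → decidable-stable (touched? d i C) λ ¬t → all (i , i<m , ¬t)

≡ᵇ-false : ∀ {i j} → i ≢ j → (i ≡ᵇ j) ≡ false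
≡ᵇ-false {i} {j} i≢j with i ≡ᵇ j in eq
... | false = refl
... | true  = contradiction (ℕ.≡ᵇ⇒≡ i j (subst T (sym eq) tt)) i≢j

module _ (ρ : Restriction) (s : State m) {d : Bool} {t : ℕ} (t<m : t < m) where

  move-at : ∀ e → e ≢ d → at (move s d t t<m) e ≡ at s e
  move-at e e≢d with e xor d in eq
  ... | true  = refl
  ... | false = contradiction (xor-false⇒≡ e d eq) e≢d

  move-at-moved : at (move s d t t<m) d ≡ t
  move-at-moved rewrite xor-same d = refl

  move-clear : ∀ n → (∀ {i k c} → n ≡ edge d i k c → i ≢ t) →
               (∀ {e i k c} → e ≢ d → n ≡ edge e i k c → Clear ρ s n) →
               Clear ρ (move s d t t<m) n
  move-clear (aux x y) _ _ = tt
  move-clear (edge e i k c) untouched clear i≡ with e ≟ᵇ d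
  ... | yes refl = contradiction (trans i≡ move-at-moved) (untouched refl)
  ... | no e≢d   = clear e≢d refl (trans i≡ (move-at e e≢d))

  -- The only toggled edges lie on line `at s (not d)` of direction `not d`; a clear name there is a
  -- fixed copy, whose value does not depend on the state.
  move-value : ∀ n → Clear ρ s n → value ρ (move s d t t<m) n ≡ value ρ s n
  move-value (aux x y) _ = refl
  move-value (edge e i k c) clear with i ℕ.≟ at s (not d)
  ... | no i≢ rewrite ≡ᵇ-false i≢ with e xor d
  ...   | true  rewrite xor-identityʳ (h s e i k) = refl
  ...   | false = refl
  move-value (edge e i k c) clear | yes i≡ with e xor d in eq
  ...   | false = refl
  ...   | true with clear (trans i≡ (cong (at s) (sym (xor-true⇒≡not e d eq))))
  ...     | refl rewrite xor-same c = refl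

-- Only a variable of p on a line through the violated vertex is in the way. The vertex then moves
-- to a line of that direction which `p ∷ C` avoids, and C keeps its values because it was clear.
relocate : ∀ ρ (s : State m) {C} p →
  (∀ d → ∃[ i ] (i < m × Untouched d i (p ∷ C))) → ClearClause ρ s C →
  Σ[ s′ ∈ State m ] (ClearClause ρ s′ (p ∷ C) ×
    (∀ {q} → q ∈ C → value ρ s′ (name q) ≡ value ρ s (name q)))
relocate {m} ρ s {C} p free clear with name p in eq
... | aux x y = s , clear′ , λ _ → refl
  where
  clear′ : ClearClause ρ s (p ∷ C)
  clear′ (here refl) = subst (Clear ρ s) (sym eq) tt
  clear′ (there q∈C) = clear q∈C
... | edge d i k c with i ℕ.≟ at s d
...   | no i≢ = s , clear′ , λ _ → refl
  where
  clear′ : ClearClause ρ s (p ∷ C)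
  clear′ (here refl) = subst (Clear ρ s) (sym eq) (λ i≡ → contradiction i≡ i≢)
  clear′ (there q∈C) = clear q∈C
...   | yes i≡ with free d
...     | t , t<m , untouched = move s d t t<m , clear′ , λ q∈C → move-value ρ s t<m _ (clear q∈C)
  where
  avoid : ∀ {q} → q ∈ p ∷ C → ∀ {i k c} → name q ≡ edge d i k c → i ≢ t
  avoid q∈ eq refl = untouched q∈ (_ , _ , eq)
  clear′ : ClearClause ρ (move s d t t<m) (p ∷ C)
  clear′ (there q∈C) = move-clear ρ s t<m _ (avoid (there q∈C)) (λ _ _ → clear q∈C)
  clear′ (here refl) = move-clear ρ s t<m _ (avoid (here refl))
    λ e≢d eq′ → contradiction (sym (edge-direction (trans (sym eq) eq′))) e≢d
    where
    edge-direction : ∀ {d e i j k l b c} → edge d i k b ≡ edge e j l c → d ≡ e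
    edge-direction refl = refl

⟦⟧-cong : ∀ ρ (s s′ : State m) p → value ρ s (name p) ≡ value ρ s′ (name p) →
          ⟦ p ⟧ (assignment ρ s) ≡ ⟦ p ⟧ (assignment ρ s′)
⟦⟧-cong ρ s s′ (pos v) eq = eq
⟦⟧-cong ρ s s′ (neg v) eq = cong not eq

resolve-true : ∀ ρ (s : State m) p → ClearClause ρ s (p ∷ C) →
               ⟦ p ⟧ (assignment ρ s) ≡ true → D ⊆ compl p ∷ C → Sound m ρ D → True ρ s C
resolve-true {C = C} {D = D} ρ s p clear p-true D⊆ sound with sound s clear-D
  where
  clear-D : ClearClause ρ s D
  clear-D q∈D with D⊆ q∈D
  ... | here refl = subst (Clear ρ s) (sym (name-compl p)) (clear (here refl))
  ... | there q∈C = clear (there q∈C)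
... | q , q∈D , q-true with D⊆ q∈D
...   | there q∈C = q , q∈C , q-true
...   | here refl = contradiction
  (trans (sym q-true) (trans (⟦compl⟧ p (assignment ρ s)) (cong not p-true))) λ ()

-- ρ makes some literal of `p ∷ C` true in every state. Either it lies in C, or it is p, which is
-- then clear as a fixed copy, and the truth of D gives a true literal of C. The spine is thus cut
-- off here.
resolve-fixed : ∀ d p → D ⊆ compl p ∷ C →
  (∀ {i} → i < m → Any (Touches d i ∘ name) (p ∷ C)) →
  ∀ ρ → Hits m ρ (satisfying d (p ∷ C)) → Sound m ρ D → Sound m ρ C
resolve-fixed {C = C} d p D⊆ touched ρ (i , i<m , ρi) sound s clear
  with satisfying-fixes d (p ∷ C) i ρ (touched i<m) ρi
... | q , k , c , there q∈C , eq , fixed = q , q∈C , fixed-true ρ s q eq fixed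
... | q , k , c , here refl , eq , fixed =
  resolve-true ρ s p clear′ (fixed-true ρ s p eq fixed) D⊆ sound
  where
  clear′ : ClearClause ρ s (p ∷ C)
  clear′ (here refl) = fixed-clear ρ s eq fixed
  clear′ (there r∈C) = clear r∈C

-- The state is changed so that p becomes clear too, the resolution step is sound there, and a true
-- literal of C stays true on the way back.
resolve-relocate : ∀ p → D ⊆ compl p ∷ C →
  (∀ d → ∃[ i ] (i < m × Untouched d i (p ∷ C))) →
  ∀ ρ → Sound m ρ D → Sound m ρ (p ∷ C) → Sound m ρ C
resolve-relocate {C = C} {m} p D⊆ free ρ sound-D sound-p s clear with relocate ρ s p free clear
... | s′ , clear′ , same = back (found (sound-p s′ clear′))
  where
  found : True ρ s′ (p ∷ C) → True ρ s′ C
  found (q , there q∈C , q-true) = q , q∈C , q-true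
  found (q , here refl , q-true) = resolve-true ρ s′ p clear′ q-true D⊆ sound-D
  back : True ρ s′ C → True ρ s C
  back (q , q∈C , q-true) = q , q∈C , trans (⟦⟧-cong ρ s s′ q (sym (same q∈C))) q-true

-- Spine clauses that miss both a row and a column are handled by relocating the
-- violated vertex.  Spine clauses increase, so it is enough that ρ satisfies the
-- first one that touches all rows or all columns: one clause per proof step.
Input-sound : ∀ m → Input Δ C → ∃[ κ ] ∀ ρ → Hits m ρ κ →
              (∀ {D} → D ∈ Δ → Sound m ρ (literals D)) → Sound m ρ C
-- A default vector: tautologies are true under every ρ.
Input-sound m (taut {p} p∈C p̄∈C) = (λ _ → false , false) , λ ρ _ _ s _ →
  split ρ s (⟦ p ⟧ (assignment ρ s)) refl
  where
  split : ∀ ρ (s : State m) b → ⟦ p ⟧ (assignment ρ s) ≡ b → True ρ s _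
  split ρ s true  eq = p , p∈C , eq
  split ρ s false eq = compl p , p̄∈C , trans (⟦compl⟧ p (assignment ρ s)) (cong not eq)
Input-sound m (leaf D∈Δ D⊆C) = (λ _ → false , false) , λ ρ _ sound s clear →
  let p , p∈D , p-true = sound D∈Δ s (clear ∘ D⊆C) in p , D⊆C p∈D , p-true
Input-sound {C = C} m (node p D∈Δ D⊆ in₁) =
  let κ , sound-p = Input-sound m in₁
  in choose κ sound-p (untouched-line m row (p ∷ C)) (untouched-line m column (p ∷ C))
  where
  choose : ∀ κ → (∀ ρ → Hits m ρ κ → (∀ {D} → D ∈ _ → Sound m ρ (literals D)) → Sound m ρ (p ∷ C)) →
    (∃[ i ] (i < m × Untouched row i (p ∷ C))) ⊎
      (∀ {i} → i < m → Any (Touches row i ∘ name) (p ∷ C)) →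
    (∃[ i ] (i < m × Untouched column i (p ∷ C))) ⊎
      (∀ {i} → i < m → Any (Touches column i ∘ name) (p ∷ C)) →
    ∃[ κ ] ∀ ρ → Hits m ρ κ → (∀ {D} → D ∈ _ → Sound m ρ (literals D)) → Sound m ρ C
  choose κ sound-p (inj₂ touched) _ = satisfying row (p ∷ C) , λ ρ hit sound →
    resolve-fixed row p D⊆ touched ρ hit (sound D∈Δ)
  choose κ sound-p (inj₁ _) (inj₂ touched) = satisfying column (p ∷ C) , λ ρ hit sound →
    resolve-fixed column p D⊆ touched ρ hit (sound D∈Δ)
  choose κ sound-p (inj₁ free-row) (inj₁ free-column) = κ , λ ρ hit sound →
    resolve-relocate p D⊆ (λ { false → free-row ; true → free-column }) ρ
      (sound D∈Δ) (sound-p ρ hit sound)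

-- One vector per added clause, hence N - 1 of them. The twin clauses of Γ persist in all later
-- CNFs, so every RAT step yields an input derivation.
derivation-sound : ∀ m → Derivation RAT Γ Δ N → (∀ {p} → var p ∈ varsCNF Δ → HasTwin Γ p) →
  ∃[ κs ] (suc (length κs) ≡ N × (∀ ρ → (∀ {κ} → κ ∈ κs → Hits m ρ κ) →
    (∀ {D} → D ∈ Γ → Sound m ρ (literals D)) → ∀ {D} → D ∈ Δ → Sound m ρ (literals D)))
derivation-sound m start twin = [] , refl , λ ρ hit sound → sound
derivation-sound {Γ = Γ} m (step {Δ = Δ} der C rule) twin
  with derivation-sound m der (twin ∘ ∈-++⁺ʳ (vars (literals C)))
... | κs , len , sound-Δ with Input-sound m (rule⇒Input rule)
  where
  Γ⊆Δ : ∀ {Δ N} → Derivation RAT Γ Δ N → Γ ⊆ Δ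
  Γ⊆Δ start          = id
  Γ⊆Δ (step der _ _) = there ∘ Γ⊆Δ der
  rule⇒Input : RAT Δ C → Input Δ (literals C)
  rule⇒Input (inj₁ resolution) = Resolution⇒Input C resolution
  rule⇒Input (inj₂ (p , p∈C , rat)) with twin {p} (∈-++⁺ˡ (∈-map⁺ var p∈C))
  ... | q , p≢q , (D , D∈Γ , D∼) , E , E∈Γ , E⊆ =
    RATFor⇒Input p C (q , p≢q , (D , Γ⊆Δ der D∈Γ , D∼) , E , Γ⊆Δ der E∈Γ , E⊆) rat
... | κ , sound-C = κ ∷ κs , cong suc len , λ ρ hit sound →
  λ { (here refl) → sound-C ρ (hit (here refl)) (sound-Δ ρ (hit ∘ there) sound)
    ; (there D∈Δ) → sound-Δ ρ (hit ∘ there) sound D∈Δ }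

-- Soundness and twins of the grid formula

parity-differs : ∀ {α β : Assignment} vs → parity α vs ≢ parity β vs →
                 ∃[ v ] (v ∈ vs × α v ≢ β v)
parity-differs []       ≢ = contradiction refl ≢
parity-differs {α} {β} (v ∷ vs) ≢ with α v ≟ᵇ β v
... | no v≢ = v , here refl , v≢
... | yes eq with parity-differs {α} {β} vs (λ eq′ → ≢ (cong₂ _xor_ eq eq′))
...   | w , w∈ , w≢ = w , there w∈ , w≢

falseLiteral-true : ∀ {α β : Assignment} v → α v ≢ β v → ⟦ falseLiteral α v ⟧ β ≡ true
falseLiteral-true {α} {β} v v≢ =
  literal-true (not (α v)) v β (¬-not (v≢ ∘ sym))

-- A clause of the equation excludes some α of wrong parity. An assignment of right parity differs
-- from α on some variable, and the literal of that variable is true.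
clauses-sound : ∀ ρ vs b →
  (∀ (s : State m) → (∀ {v} → v ∈ vs → Clear ρ s (proj₁ (decode v))) →
    parity (assignment ρ s) vs ≡ b) →
  ∀ {C} → C ∈ clauses (vs , b) → Sound m ρ (literals C)
clauses-sound ρ vs b holds C∈ s clear with ∈-clauses⁻ vs b C∈
... | α , refl , odd with parity-differs {α} {assignment ρ s} vs
  (λ eq → odd (trans eq (holds s λ v∈ → subst (Clear ρ s ∘ proj₁ ∘ decode) (var-literal (not (α _)) _)
    (clear (∈-map⁺ (falseLiteral α) v∈)))))
...   | v , v∈ , v≢ = falseLiteral α v , ∈-map⁺ (falseLiteral α) v∈ ,
  falseLiteral-true {α} {assignment ρ s} v v≢

parity-unprimed : ∀ ρ (s : State m) n ns →
  parity (assignment ρ s) (unprimed (n ∷ ns)) ≡ value ρ s n xor parity (assignment ρ s) (unprimed ns)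
parity-unprimed ρ s n ns =
  cong (λ n,t → value ρ s (proj₁ n,t) xor parity (assignment ρ s) (unprimed ns)) (decode-encode n false)

-- The fixed copy carries a bit and the other copy that bit plus the edge value, so the bit cancels.
edgePair-parity : ∀ ρ (s : State m) d i k ns →
  parity (assignment ρ s) (unprimed (edgePair d i k ++ ns)) ≡
  h s d i k xor parity (assignment ρ s) (unprimed ns)
edgePair-parity ρ s d i k ns = trans (parity-unprimed ρ s (edge d i k false) (edge d i k true ∷ ns))
  (trans (cong (value ρ s (edge d i k false) xor_) (parity-unprimed ρ s (edge d i k true) ns))
    (cancel (proj₁ (ρ i)) (proj₂ (ρ i)) (h s d i k) (parity (assignment ρ s) (unprimed ns))))
  where
  cancel : ∀ c r h x →
    (if c then r xor h else r) xor ((if not c then r xor h else r) xor x) ≡ h xor x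
  cancel false false h     x = refl
  cancel false true  false x = not-involutive x
  cancel false true  true  x = refl
  cancel true  false h     x = refl
  cancel true  true  false x = not-involutive x
  cancel true  true  true  x = refl

ClearNames : Restriction → State m → List Name → Set
ClearNames ρ s ns = ∀ {n} → n ∈ ns → Clear ρ s n

site-sound : ∀ ρ (s : State m) t → t ∈ sites m → ClearNames ρ s (names t) →
             ∀ {vs b} → (vs , b) ∈ equations t → parity (assignment ρ s) vs ≡ b
site-sound {m} ρ s (vertex x y) t∈ clear (here refl) = begin
  parity (assignment ρ s) (unprimed (names (vertex x y)))
    ≡⟨ edgePair-parity ρ s row x y e₁ ⟩
  r xor _ ≡⟨ cong (r xor_) (edgePair-parity ρ s row x (suc y) e₂) ⟩
  r xor (r′ xor _)
    ≡⟨ cong (λ z → r xor (r′ xor z)) (edgePair-parity ρ s column y x e₃) ⟩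
  r xor (r′ xor (c xor _))
    ≡⟨ cong (λ z → r xor (r′ xor (c xor z))) (edgePair-parity ρ s column y (suc x) []) ⟩
  r xor (r′ xor (c xor (c′ xor false)))
    ≡⟨ solve 4 (λ r r′ c c′ →
         r :+ (r′ :+ (c :+ (c′ :+ con false))) := (r :+ r′) :+ (c :+ c′)) refl r r′ c c′ ⟩
  (r xor r′) xor (c xor c′) ≡⟨ vertices s x y ⟩
  (x ≡ᵇ at s row) ∧ (y ≡ᵇ at s column) ≡⟨ elsewhere ⟩
  false ∎
  where
  open ≡-Reasoning
  open xor-∧-Solver
  e₃ = edgePair column y (suc x)
  e₂ = edgePair column y x ++ e₃
  e₁ = edgePair row x (suc y) ++ e₂
  r  = h s row x y
  r′ = h s row x (suc y)
  c  = h s column y x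
  c′ = h s column y (suc x)
  -- The equation contains both copies of an edge on row x. If x were the violated row, clearness
  -- would make both of them the fixed copy.
  elsewhere : (x ≡ᵇ at s row) ∧ (y ≡ᵇ at s column) ≡ false
  elsewhere with x ℕ.≟ at s row
  ... | no x≢  rewrite ≡ᵇ-false x≢ = refl
  ... | yes x≡ = contradiction
    (trans (clear (here refl) x≡) (sym (clear (there (here refl)) x≡))) λ ()
site-sound {m} ρ s (boundary d i k b) t∈ clear (here refl) =
  trans (edgePair-parity ρ s d i k []) (trans (xor-identityʳ _) boundary-value)
  where
  on-vertex : boundary d i k b ∈ vertexSites m → h s d i k ≡ b
  on-vertex t∈ with ∈-cartesianProductWith⁻ vertex (upTo m) (upTo m) t∈
  ... | _ , _ , _ , _ , ()
  on-source : boundary d i k b ∈ sourceSites m → h s d i k ≡ b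
  on-source t∈ with ∈-cartesianProductWith⁻
    (λ d i → boundary d i 0 (source d i)) (row ∷ [ column ]) (upTo m) t∈
  ... | _ , _ , _ , _ , refl = entry s d i
  on-sink : boundary d i k b ∈ sinkSites m → h s d i k ≡ b
  on-sink t∈ with ∈-cartesianProductWith⁻
    (λ d i → boundary d i m false) (row ∷ [ column ]) (upTo m) t∈
  ... | _ , _ , _ , _ , refl = exit s d i
  on-auxiliary : boundary d i k b ∈ auxiliarySites m → h s d i k ≡ b
  on-auxiliary t∈ with ∈-cartesianProductWith⁻ auxiliary (upTo (suc m)) (upTo (suc m)) t∈
  ... | _ , _ , _ , _ , ()
  boundary-value : h s d i k ≡ b
  boundary-value = [ on-vertex , [ on-source , [ on-sink , on-auxiliary ]′
    ∘ ∈-++⁻ (sinkSites m) ]′ ∘ ∈-++⁻ (sourceSites m) ]′ (∈-++⁻ (vertexSites m) t∈)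

data Origin (m : ℕ) (C : Clause) : Set where
  main : ∀ t → t ∈ sites m → ∀ vs b → (vs , b) ∈ equations t → C ∈ clauses (vs , b) → Origin m C
  twin : ∀ t → t ∈ sites m → ∀ n → n ∈ names t → C ∈ clauses (twins n) → Origin m C

origin : ∀ m {C} → C ∈ formula m → Origin m C
origin m C∈ with ∈-formula⁻ m C∈
... | t , t∈ , C∈block with ∈-++⁻ (concatMap clauses (equations t)) C∈block
...   | inj₁ C∈main with find (∈-concatMap⁻ clauses {xs = equations t} C∈main)
...     | (vs , b) , e∈ , C∈e = main t t∈ vs b e∈ C∈e
origin m C∈ | t , t∈ , C∈block | inj₂ C∈twins
  with find (∈-concatMap⁻ (clauses ∘ twins) {xs = names t} C∈twins)
... | n , n∈ , C∈n = twin t t∈ n n∈ C∈n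

equation-vars : ∀ t {vs b} → (vs , b) ∈ equations t → vs ≡ unprimed (names t)
equation-vars (vertex x y)       (here refl) = refl
equation-vars (boundary d i k b) (here refl) = refl

formula-sound : ∀ m ρ {C} → C ∈ formula m → Sound m ρ (literals C)
formula-sound m ρ C∈ with origin m C∈
-- The assignment of a state depends on the name only, so twins agree in every state, clear or not.
... | twin t t∈ n n∈ C∈n = clauses-sound ρ (proj₁ (twins n)) false (λ s _ → equal s) C∈n
  where
  equal : ∀ (s : State m) → parity (assignment ρ s) (proj₁ (twins n)) ≡ false
  equal s rewrite decode-encode n false | decode-encode n true
    | xor-identityʳ (value ρ s n) = xor-same (value ρ s n)
... | main t t∈ vs b e∈ C∈e = clauses-sound ρ vs b
  (λ s clear → site-sound ρ s t t∈ (clear-names s clear) e∈) C∈e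
  where
  clear-names : ∀ (s : State m) → (∀ {v} → v ∈ vs → Clear ρ s (proj₁ (decode v))) →
                ClearNames ρ s (names t)
  clear-names s clear {n} n∈ = subst (Clear ρ s ∘ proj₁) (decode-encode n false)
    (clear (subst (encode n false ∈_) (sym (equation-vars t e∈)) (∈-map⁺ _ n∈)))

block-twins : ∀ m {t n} → t ∈ sites m → n ∈ names t → clauses (twins n) ⊆ formula m
block-twins m {t} t∈ n∈ C∈ = block⊆formula m t∈
  (∈-++⁺ʳ (concatMap clauses (equations t)) (∈-concatMap⁺ (clauses ∘ twins) (lose n∈ C∈)))

twin-clause : ∀ n b → ∃[ C ] (C ∈ clauses (twins n) ×
  literals C ≡ literal b (encode n false) ∷ [ literal (not b) (encode n true) ])
-- This assignment gives the two twins opposite values, with the signs prescribed by b.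
twin-clause n b with clauses-complete (λ v → not (proj₂ (decode v) xor b)) (proj₁ (twins n)) false odd
  where
  odd : parity (λ v → not (proj₂ (decode v) xor b)) (proj₁ (twins n)) ≢ false
  odd rewrite decode-encode n false | decode-encode n true = unequal b
    where
    unequal : ∀ b → not b xor (not (not b) xor false) ≢ false
    unequal false ()
    unequal true  ()
... | C , C∈ , eq = C , C∈ , trans eq falsified-twins
  where
  falsified-twins : falsified (λ v → not (proj₂ (decode v) xor b)) (proj₁ (twins n)) ≡
                    literal b (encode n false) ∷ [ literal (not b) (encode n true) ]
  falsified-twins rewrite decode-encode n false | decode-encode n true
    | not-involutive b = refl

compl-literal : ∀ b v → compl (literal b v) ≡ literal (not b) v
compl-literal true  v = refl
compl-literal false v = refl

swap-∼ : ∀ {p q} → (p ∷ [ q ]) ∼[ set ] (q ∷ [ p ])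
swap-∼ = mk⇔ swap swap
  where
  swap : ∀ {r p q : Literal} → r ∈ p ∷ [ q ] → r ∈ q ∷ [ p ]
  swap (here refl)         = there (here refl)
  swap (there (here refl)) = here refl

≡⇒∼ : C ≡ D → C ∼[ set ] D
≡⇒∼ refl = mk⇔ id id

encode-twins : ∀ n → encode n false ≢ encode n true
encode-twins n eq with encode-injective eq
... | ()

HasTwin-literal : ∀ n b t → clauses (twins n) ⊆ Γ → HasTwin Γ (literal b (encode n t))
HasTwin-literal n b false ⊆Γ with twin-clause n (not b) | twin-clause n b
... | D , D∈ , D≡ | E , E∈ , E≡ =
  literal b (encode n true) ,
  (λ eq → encode-twins n (trans (sym (var-literal b _)) (trans eq (var-literal b _)))) ,
  (D , ⊆Γ D∈ , ≡⇒∼ (trans D≡ (cong₂ (λ p b → p ∷ [ literal b (encode n true) ])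
    (sym (compl-literal b _)) (not-involutive b)))) ,
  E , ⊆Γ E∈ , subst (λ p → literals E ⊆ p ∷ [ literal b (encode n false) ])
    (sym (compl-literal b _)) (∼⇒⊆ swap-∼ ∘ subst (_ ∈_) E≡)
HasTwin-literal n b true ⊆Γ with twin-clause n b | twin-clause n (not b)
... | D , D∈ , D≡ | E , E∈ , E≡ =
  literal b (encode n false) ,
  (λ eq → encode-twins n (trans (sym (var-literal b _)) (trans (sym eq) (var-literal b _)))) ,
  (D , ⊆Γ D∈ , subst₂ (λ L r → L ∼[ set ] (r ∷ [ literal b (encode n false) ]))
    (sym D≡) (sym (compl-literal b _)) swap-∼) ,
  E , ⊆Γ E∈ , subst (literals E ⊆_) (trans E≡ (cong₂ (λ p b → p ∷ [ literal b (encode n true) ])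
    (sym (compl-literal b _)) (not-involutive b))) id

∈-varsCNF⁻ : ∀ Γ {v} → v ∈ varsCNF Γ → ∃[ C ] (C ∈ Γ × v ∈ vars (literals C))
∈-varsCNF⁻ Γ v∈ = find (∈-concatMap⁻ (vars ∘ literals) {xs = Γ} v∈)

formula-var : ∀ m {v} → v ∈ varsCNF (formula m) →
  ∃[ n ] ∃[ t ] (v ≡ encode n t × clauses (twins n) ⊆ formula m)
formula-var m {v} v∈ with ∈-varsCNF⁻ (formula m) v∈
... | C , C∈ , v∈C with origin m C∈
...   | main t t∈ vs b e∈ C∈e with ∈-clauses⁻ vs b C∈e
...     | α , refl , _ with ∈-map⁻ (λ n → encode n false)
  (subst (v ∈_) (trans (vars-falsified α vs) (equation-vars t e∈)) v∈C)
...       | n , n∈ , eq = n , false , eq , block-twins m t∈ n∈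
formula-var m {v} v∈ | C , C∈ , v∈C | twin t t∈ n n∈ C∈n
  with ∈-clauses⁻ (proj₁ (twins n)) false C∈n
... | α , refl , _ with subst (v ∈_) (vars-falsified α (proj₁ (twins n))) v∈C
...   | here eq         = n , false , eq , block-twins m t∈ n∈
...   | there (here eq) = n , true , eq , block-twins m t∈ n∈

formula-HasTwin : ∀ m {p} → var p ∈ varsCNF (formula m) → HasTwin (formula m) p
formula-HasTwin m {p} p∈ with formula-var m p∈
... | n , t , eq , twins⊆ = subst (HasTwin (formula m))
  (trans (cong (literal (sign p)) (sym eq)) (literal-sign p)) (HasTwin-literal n (sign p) t twins⊆)
  where
  literal-sign : ∀ p → literal (sign p) (var p) ≡ p
  literal-sign (pos v) = refl
  literal-sign (neg v) = refl

-- The lower bound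

¬⊥-sound : ∀ ρ → State m → ⊥ᶜ ∈ᶜ Δ → ¬ (∀ {D} → D ∈ Δ → Sound m ρ (literals D))
¬⊥-sound ρ s ⊥∈Δ sound with ∈ᶜ⇒∈ ⊥ᶜ ⊥∈Δ
... | E , E∈Δ , _ , E⊆[] with sound E∈Δ s (λ p∈E → contradiction (E⊆[] p∈E) λ ())
...   | p , p∈E , _ = contradiction (E⊆[] p∈E) λ ()

lower-bound : State m → Proof⁻ RAT (formula m) N → 4 ^ m ≤ N * 3 ^ m
lower-bound {m} {N} s (Δ , der , ⊥∈Δ , vars⊆) =
  let κs , len , sound = derivation-sound m der (formula-HasTwin m ∘ vars⊆)
  in ℕ.≮⇒≥ λ lt →
    let ρ , hit = hitting m κs (ℕ.≤-<-trans (ℕ.*-monoˡ-≤ (3 ^ m)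
                    (ℕ.≤-trans (ℕ.n≤1+n (length κs)) (ℕ.≤-reflexive len))) lt)
    in ¬⊥-sound ρ s ⊥∈Δ (sound ρ hit (formula-sound m ρ))

-- The factor 3 in the side length comes from (4/3)³ ≥ 2, that is, 2 · 27 = 54 ≤ 64. The summand 1
-- keeps the grid nonempty at n = 0, so that a state exists.
exponential : ∀ n N → Proof⁻ RAT (formula (3 * suc n)) N → 2 ^ n ≤ N ^ 1
exponential n N proof = ℕ.*-cancelʳ-≤ (2 ^ n) (N ^ 1) (3 ^ (3 * suc n)) {{ℕ.m^n≢0 3 (3 * suc n)}} (begin
  2 ^ n * 3 ^ (3 * suc n)      ≤⟨ ℕ.*-mono-≤ (ℕ.^-monoʳ-≤ 2 (ℕ.n≤1+n n)) ℕ.≤-refl ⟩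
  2 ^ suc n * 3 ^ (3 * suc n)  ≡⟨ cong (2 ^ suc n *_) (ℕ.^-*-assoc 3 3 (suc n)) ⟨
  2 ^ suc n * 27 ^ suc n       ≡⟨ ^-distribʳ-* (suc n) 2 27 ⟨
  54 ^ suc n                   ≤⟨ ℕ.^-monoˡ-≤ (suc n) (ℕ.m≤m+n 54 10) ⟩
  64 ^ suc n                   ≡⟨ ℕ.^-*-assoc 4 3 (suc n) ⟩
  4 ^ (3 * suc n)              ≤⟨ lower-bound (initial (n + 2 * suc n)) proof ⟩
  N * 3 ^ (3 * suc n)          ≡⟨ cong (_* 3 ^ (3 * suc n)) (ℕ.^-identityʳ N) ⟨
  N ^ 1 * 3 ^ (3 * suc n)      ∎)
  where
  open ℕ.≤-Reasoning
  ^-distribʳ-* : ∀ k a b → (a * b) ^ k ≡ a ^ k * b ^ k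
  ^-distribʳ-* zero    a b = refl
  ^-distribʳ-* (suc k) a b = trans (cong (a * b *_) (^-distribʳ-* k a b))
    (solve 4 (λ a b x y → a :* b :* (x :* y) := a :* x :* (b :* y)) refl a b (a ^ k) (b ^ k))
    where open +-*-Solver

private variable
  c d : ℕ
  Q : Var → Set

-- Bounded SBC derivations

-- The CNF where the two sequences meet is counted once.
append : ∀ {R M} → Derivation R Γ Δ M → Derivation R Δ Θ N →
         ∃[ K ] (suc K ≡ N + M × Derivation R Γ Θ K)
append der start             = _ , refl , der
append der (step der′ C rule) with append der der′
... | K , eq , der″ = suc K , cong suc eq , step der″ C rule

-- c bounds the number of added clauses, one less than the size, so that bounds add up under
-- composition. The field `new` serves both the ban on new variables and the freshness of names
-- still to be defined.
record Steps (Q : Var → Set) (Γ Δ : CNF) (c : ℕ) : Set where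
  constructor steps
  field
    {size}     : ℕ
    derivation : Derivation SBC Γ Δ size
    bounded    : size ≤ suc c
    extends    : Γ ⊆ Δ
    new        : ∀ {C} → C ∈ Δ → C ∈ Γ ⊎ (∀ {v} → v ∈ vars (literals C) → Q v)

open Steps

Reach : (Var → Set) → CNF → ℕ → (CNF → Set) → Set
Reach Q Γ c P = ∃[ Δ ] (Steps Q Γ Δ c × P Δ)

stay : ∀ {P} → P Γ → Reach Q Γ c P
stay p = _ , steps start (s≤s z≤n) id inj₁ , p

add : ∀ C → SBC Γ C → (∀ {v} → v ∈ vars (literals C) → Q v) → Steps Q Γ (C ∷ Γ) 1
add C rule q = steps (step start C rule) ℕ.≤-refl there
  λ { (here refl) → inj₂ q ; (there D∈) → inj₁ D∈ }

_⨾_ : Steps Q Γ Δ c → Steps Q Δ Θ d → Steps Q Γ Θ (c + d)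
_⨾_ {c = c} {d = d} st st′ with append (derivation st) (derivation st′)
... | K , eq , der = steps der K≤ (extends st′ ∘ extends st)
  λ C∈ → [ new st , inj₂ ]′ (new st′ C∈)
  where
  open ℕ.≤-Reasoning
  K≤ : K ≤ suc (c + d)
  K≤ = s≤s⁻¹ (begin
    suc K                  ≡⟨ eq ⟩
    size st′ + size st     ≤⟨ ℕ.+-mono-≤ (bounded st′) (bounded st) ⟩
    suc d + suc c          ≡⟨ cong suc (ℕ.+-comm d (suc c)) ⟩
    suc (suc (c + d))      ∎)

_>>=_ : ∀ {P P′} → Reach Q Γ c P → (∀ {Δ} → Steps Q Γ Δ c → P Δ → Reach Q Δ d P′) →
        Reach Q Γ (c + d) P′
(Δ , st , p) >>= f with f st p
... | Θ , st′ , p′ = Θ , st ⨾ st′ , p′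

relax : c ≤ d → Steps Q Γ Δ c → Steps Q Γ Δ d
relax c≤d st = record { derivation = derivation st ; bounded = ℕ.≤-trans (bounded st) (s≤s c≤d)
                      ; extends = extends st ; new = new st }

relaxᴿ : ∀ {P} → c ≤ d → Reach Q Γ c P → Reach Q Γ d P
relaxᴿ c≤d (Δ , st , p) = Δ , relax c≤d st , p

iterate : (P : ℕ → CNF → Set) → ∀ k →
  (∀ {i Δ} → i < k → Γ ⊆ Δ → P i Δ → Reach Q Δ c (P (suc i))) →
  P 0 Γ → Reach Q Γ (k * c) (P k)
iterate P zero    f p = stay p
iterate {c = c} P (suc k) f p = relaxᴿ (ℕ.≤-reflexive (ℕ.+-comm (k * c) c))
  (iterate P k (λ i<k → f (ℕ.m<n⇒m<1+n i<k)) p >>= λ st → f ℕ.≤-refl (extends st))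

weaken : ∀ {D} C → D ∈ Γ → literals D ⊆ literals C → SBC Γ C
weaken {D = D} C D∈Γ D⊆C = inj₁ (inj₂ (D , ∈⇒∈ᶜ D∈Γ , literals C ,
  mk⇔ (∈-++⁺ʳ (literals D)) (λ p∈ → [ D⊆C , id ]′ (∈-++⁻ (literals D) p∈))))

open DecMembership ℕ._≟_ using (_∈?_)
open DecMembership Defs._≟_ using () renaming (_∈?_ to _∈ˡ?_)

-- Three steps: each premise is weakened to the full clause over `u ∷ ws`, and the two are resolved
-- on u.
eliminate-at : ∀ α u ws → u ∉ ws → (∀ {v} → v ∈ u ∷ ws → Q v) →
  (∀ b → ∃[ C ] (C ∈ Γ × literals C ⊆ falsified (α [ u ≔ b ]) (u ∷ ws))) →
  Reach Q Γ 3 (falsified-clause α ws ∈_)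
eliminate-at {Q = Q} {Γ = Γ} α u ws u∉ q given with given false | given true
... | D , D∈ , D⊆ | E , E∈ , E⊆ =
  _ , (add D′ (weaken D′ D∈ D⊆) (allowed (α [ u ≔ false ]) (u ∷ ws) q)
    ⨾ (add E′ (weaken E′ (there E∈) E⊆) (allowed (α [ u ≔ true ]) (u ∷ ws) q)
    ⨾ add R resolvent (allowed α ws (q ∘ there)))) , here refl
  where
  D′ = falsified-clause (α [ u ≔ false ]) (u ∷ ws)
  E′ = falsified-clause (α [ u ≔ true ]) (u ∷ ws)
  R  = falsified-clause α ws
  allowed : ∀ α vs → (∀ {v} → v ∈ vs → Q v) → ∀ {v} → v ∈ vars (falsified α vs) → Q v
  allowed α vs q v∈ = q (subst (_ ∈_) (vars-falsified α vs) v∈)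
  split : ∀ b → falsified (α [ u ≔ b ]) (u ∷ ws) ≡ literal (not b) u ∷ falsified α ws
  split b = cong₂ _∷_ (cong (λ b → literal (not b) u) (≔-same α u b))
    (falsified-cong {α [ u ≔ b ]} {α} ws λ v∈ → ≔-other α b λ { refl → u∉ v∈ })
  u∉vars : u ∉ vars (falsified α ws)
  u∉vars u∈ = u∉ (subst (u ∈_) (vars-falsified α ws) u∈)
  resolvent : SBC (E′ ∷ D′ ∷ Γ) R
  resolvent = inj₁ (inj₁ (u , D′ , E′ , ∈⇒∈ᶜ {D = D′} (there (here refl)) , ∈⇒∈ᶜ {D = E′} (here refl) ,
    falsified α ws , falsified α ws , u∉vars , u∉vars , ≡⇒∼ (split false) , ≡⇒∼ (split true) ,
    mk⇔ ∈-++⁺ˡ (λ p∈ → [ id , id ]′ (∈-++⁻ (falsified α ws) p∈))))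

Refutes-mono : ∀ {ws} e → Γ ⊆ Δ → Refutes Γ ws e → Refutes Δ ws e
Refutes-mono e Γ⊆Δ ref α odd with ref α odd
... | C , C∈ , C⊆ = C , Γ⊆Δ C∈ , C⊆

forEach : ∀ {A : Set} (P : A → CNF → Set) → (∀ {a Γ Δ} → Γ ⊆ Δ → P a Γ → P a Δ) →
  (∀ a {Δ} → Γ ⊆ Δ → Reach Q Δ c (P a)) →
  ∀ as → Reach Q Γ (length as * c) (λ Δ → ∀ {a} → a ∈ as → P a Δ)
forEach P mono f []       = stay λ ()
forEach P mono f (a ∷ as) = f a id >>= λ st p →
  mono-Reach p (forEach P mono (λ a ⊆ → f a (⊆ ∘ extends st)) as)
  where
  mono-Reach : P a Δ → Reach Q Δ c (λ Δ → ∀ {b} → b ∈ as → P b Δ) →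
               Reach Q Δ c (λ Δ → ∀ {b} → b ∈ a ∷ as → P b Δ)
  mono-Reach p (Δ , st , ps) = Δ , st ,
    λ { (here refl) → mono (extends st) p ; (there b∈) → ps b∈ }

length-assignments : ∀ vs → length (assignments vs) ≡ 2 ^ length vs
length-assignments []       = refl
length-assignments (v ∷ vs) = trans (double (assignments vs)) (cong (2 *_) (length-assignments vs))
  where
  double : ∀ as →
    length (concatMap (λ α → (α [ v ≔ false ]) ∷ [ α [ v ≔ true ] ]) as) ≡ 2 * length as
  double []       = refl
  double (a ∷ as) = trans (cong (2 +_) (double as)) (sym (ℕ.*-suc 2 (length as)))

-- For u outside `ws`, the value of u does not affect the equation, so a violation persists under
-- both values and the two refuting clauses resolve on u; this is repeated for all assignments of
-- `ws`. If u is a repetition, the falsified literals are the same already.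
eliminate : ∀ u ws {vs b} → vs ⊆ ws → (∀ {v} → v ∈ u ∷ ws → Q v) → Refutes Γ (u ∷ ws) (vs , b) →
            Reach Q Γ (2 ^ length ws * 3) (λ Δ → Refutes Δ ws (vs , b))
eliminate {Q = Q} {Γ = Γ} u ws {vs} {b} vs⊆ws q ref with u ∈? ws
... | yes u∈ws = stay λ α odd →
  let C , C∈ , C⊆ = ref α odd in C , C∈ , λ {_} p∈ → absorb α (C⊆ p∈)
  where
  absorb : ∀ α → falsified α (u ∷ ws) ⊆ falsified α ws
  absorb α (here refl) = ∈-map⁺ (falseLiteral α) u∈ws
  absorb α (there p∈)  = p∈
... | no u∉ws = finish (forEach At At-mono derive (assignments ws))
  where
  At : Assignment → CNF → Set
  At α Δ = parity α vs ≢ b → ∃[ C ] (C ∈ Δ × literals C ⊆ falsified α ws)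
  At-mono : ∀ {α Γ Δ} → Γ ⊆ Δ → At α Γ → At α Δ
  At-mono Γ⊆Δ at odd with at odd
  ... | C , C∈ , C⊆ = C , Γ⊆Δ C∈ , C⊆
  derive : ∀ α {Δ} → Γ ⊆ Δ → Reach Q Δ 3 (At α)
  derive α Γ⊆Δ with parity α vs ≟ᵇ b
  ... | yes even = stay λ odd → contradiction even odd
  ... | no odd with eliminate-at α u ws u∉ws q
    (λ x → Refutes-mono (vs , b) Γ⊆Δ ref (α [ u ≔ x ]) λ even → odd (trans
      (sym (parity-cong {α [ u ≔ x ]} {α} vs λ v∈ → ≔-other α x λ { refl → u∉ws (vs⊆ws v∈) })) even))
  ...   | Θ , st , R∈ = Θ , st , λ _ → _ , R∈ , id
  finish : Reach Q Γ (length (assignments ws) * 3) (λ Δ → ∀ {α} → α ∈ assignments ws → At α Δ) →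
           Reach Q Γ (2 ^ length ws * 3) (λ Δ → Refutes Δ ws (vs , b))
  finish (Δ , st , at) = Δ , relax (ℕ.≤-reflexive (cong (_* 3) (length-assignments ws))) st , refutes
    where
    refutes : Refutes Δ ws (vs , b)
    refutes α odd with assignments-complete α ws
    ... | β , β∈ , β≡α
      with at β∈ (λ even → odd (trans (sym (parity-cong {β} {α} vs (β≡α ∘ vs⊆ws))) even))
    ...   | C , C∈ , C⊆ = C , C∈ , λ p∈ → subst (_ ∈_) (falsified-cong {β} {α} ws β≡α) (C⊆ p∈)

-- The number of assignments halves with each variable, so the costs form a geometric sum.
eliminateAll : ∀ us {vs b} → (∀ {v} → v ∈ us ++ vs → Q v) → Refutes Γ (us ++ vs) (vs , b) →
               Reach Q Γ (3 * 2 ^ (length us + length vs)) (_⊩ (vs , b))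
eliminateAll []       q ref = stay ref
eliminateAll (u ∷ us) {vs} q ref = relaxᴿ (ℕ.≤-reflexive cost)
  (eliminate u (us ++ vs) (∈-++⁺ʳ us) q ref >>= λ _ → eliminateAll us (q ∘ there))
  where
  open ≡-Reasoning
  x = 2 ^ (length us + length vs)
  cost : 2 ^ length (us ++ vs) * 3 + 3 * x ≡ 3 * (2 * x)
  cost = trans (cong (λ l → 2 ^ l * 3 + 3 * x) (length-++ us))
    (solve 1 (λ x → x :* con 3 :+ con 3 :* x := con 3 :* (con 2 :* x)) refl x)
    where open +-*-Solver

Holds : Assignment → Equation → Set
Holds α (vs , b) = parity α vs ≡ b

Known : (Var → Set) → CNF → Equation → Set
Known Q Γ e = Γ ⊩ e × (∀ {v} → v ∈ proj₁ e → Q v)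

Known-mono : ∀ e → Γ ⊆ Δ → Known Q Γ e → Known Q Δ e
Known-mono e Γ⊆Δ (ref , q) = Refutes-mono e Γ⊆Δ ref , q

-- The widest inference below mentions 24 variables, counted with repetitions.
abstract
  unitCost : ℕ
  unitCost = 3 * 2 ^ 24

  unitCost-bound : ∀ k → k ≤ 24 → 3 * 2 ^ k ≤ unitCost
  unitCost-bound k k≤ = ℕ.*-monoʳ-≤ 3 (ℕ.^-monoʳ-≤ 2 k≤)

-- Resolution is complete on boundedly many variables: a violation of the conclusion violates a
-- premise and so falsifies one of its clauses; then the variables of the premises are eliminated.
infer : ∀ es {vs b} → All (Known Q Γ) es → (∀ α → All (Holds α) es → parity α vs ≡ b) →
        (∀ {v} → v ∈ vs → Q v) → {T (length (concatMap proj₁ es) + length vs ≤ᵇ 24)} →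
        Reach Q Γ unitCost (λ Δ → Known Q Δ (vs , b))
infer {Q = Q} {Γ = Γ} es {vs} {b} known implies q {small} =
  let Δ , st , ref = relaxᴿ
        (unitCost-bound _ (ℕ.≤ᵇ⇒≤ (length (concatMap proj₁ es) + length vs) 24 small))
        (eliminateAll (concatMap proj₁ es) allowed refutes)
  in Δ , st , ref , q
  where
  allowed : ∀ {v} → v ∈ concatMap proj₁ es ++ vs → Q v
  allowed v∈ with ∈-++⁻ (concatMap proj₁ es) v∈
  ... | inj₂ v∈vs = q v∈vs
  ... | inj₁ v∈es with find (∈-concatMap⁻ proj₁ {xs = es} v∈es)
  ...   | e , e∈ , v∈e = proj₂ (All.lookup known e∈) v∈e
  holds? : ∀ α e → Dec (Holds α e)
  holds? α (vs , b) = parity α vs ≟ᵇ b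
  refutes : Refutes Γ (concatMap proj₁ es ++ vs) (vs , b)
  refutes α odd with find (¬All⇒Any¬ (holds? α) es (odd ∘ implies α))
  ... | e , e∈ , violated with proj₁ (All.lookup known e∈) α violated
  ...   | C , C∈ , C⊆ = C , C∈ , λ p∈ → widen (C⊆ p∈)
    where
    widen : falsified α (proj₁ e) ⊆ falsified α (concatMap proj₁ es ++ vs)
    widen p∈ with ∈-map⁻ (falseLiteral α) p∈
    ... | v , v∈ , refl = ∈-map⁺ (falseLiteral α) (∈-++⁺ˡ (∈-concatMap⁺ proj₁ (lose e∈ v∈)))

-- Definitions by set-blocked clauses

-- The twins of n occur with opposite signs, as in the twin clauses. Such a clause contains a pivot
-- of either sign, so it never obstructs set-blockedness.
Inert : Name → Literals → Set
Inert n C = ∃[ b ] ∀ t → literal (t xor b) (encode n t) ∈ C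

Absent : Name → Literals → Set
Absent n C = ∀ t → encode n t ∉ vars C

Fresh : Name → CNF → Set
Fresh n Γ = ∀ {C} → C ∈ Γ → Inert n (literals C) ⊎ Absent n (literals C)

definition : Name → List Var → Equation
definition n vs = encode n false ∷ vs , false

pivots : Name → Bool → Literals
pivots n b = map (λ t → literal b (encode n t)) (true ∷ [ false ])

definitionLiterals : Name → List Var → Assignment → Literals
definitionLiterals n vs α = pivots n (parity α vs) ++ falsified α vs

∈-pivots : ∀ n b t → literal b (encode n t) ∈ pivots n b
∈-pivots n b true  = here refl
∈-pivots n b false = there (here refl)

∈-pivots⁻ : ∀ n b {p} → p ∈ pivots n b → ∃[ t ] p ≡ literal b (encode n t)
∈-pivots⁻ n b (here refl)         = true , refl
∈-pivots⁻ n b (there (here refl)) = false , refl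

-- The twin `encode n true` comes first because it is eliminated to leave the definition of the
-- other twin.
definitionVars : Name → List Var → List Var
definitionVars n vs = encode n true ∷ encode n false ∷ vs

vars-definition : ∀ n vs α → vars (definitionLiterals n vs α) ≡ definitionVars n vs
vars-definition n vs α = cong₂ _∷_ (var-literal (parity α vs) _)
  (cong₂ _∷_ (var-literal (parity α vs) _) (vars-falsified α vs))

module _ (n : Name) (vs : List Var) (avoids : ∀ t → encode n t ∉ vs) where

  -- `override α` falsifies the definition clause of α, which thereby inherits its nontautology.
  half override : Assignment → Assignment
  half α = α [ encode n false ≔ not (parity α vs) ]
  override α = half α [ encode n true ≔ not (parity α vs) ]

  override-other : ∀ α {v} → v ∈ vs → override α v ≡ α v
  override-other α {v} v∈ = trans
    (≔-other (half α) {encode n true} {v} (not (parity α vs)) (λ { refl → avoids true v∈ }))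
    (≔-other α {encode n false} {v} (not (parity α vs)) λ { refl → avoids false v∈ })

  definition-falsified : ∀ α → falsified (override α) (definitionVars n vs) ≡ definitionLiterals n vs α
  definition-falsified α = cong₂ _∷_
    (cong (λ b → literal b _) (trans
      (cong not (≔-same (half α) (encode n true) (not (parity α vs)))) (not-involutive _)))
    (cong₂ _∷_
      (cong (λ b → literal b _) (trans (cong not (trans
        (≔-other (half α) (not (parity α vs)) (encode-twins n))
        (≔-same α (encode n false) (not (parity α vs))))) (not-involutive _)))
      (falsified-cong {override α} {α} vs (override-other α)))

  definitionClause : Assignment → Clause
  definitionClause α = clause (definitionLiterals n vs α)
    (subst (λ C → ¬ Tautological C) (definition-falsified α)
      (nontautological (falsified-clause (override α) (definitionVars n vs))))

  Harmless : CNF → Set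
  Harmless Γ = ∀ C → C ∈ Γ → (Inert n (literals C) ⊎ Absent n (literals C)) ⊎
                                (∃[ α ] C ≡ definitionClause α)

  tautological : ∀ {α β : Assignment} {v} → α v ≢ β v → ∀ {C D} →
    falseLiteral α v ∈ C → falseLiteral β v ∈ D → Tautological (C ++ D)
  tautological {α} {β} {v} ≢ {C} p∈ q∈ with α v | β v
  ... | true  | true  = contradiction refl ≢
  ... | true  | false = v , ∈-++⁺ʳ C q∈ , ∈-++⁺ˡ p∈
  ... | false | true  = v , ∈-++⁺ˡ p∈ , ∈-++⁺ʳ C q∈
  ... | false | false = contradiction refl ≢

  -- An inert clause also meets L, and an absent one misses its complement. The definition clause of
  -- β shares the pivots if the parities agree; otherwise α and β differ on some variable of `vs`,
  -- whose two literals clash outside the pivots.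
  set-blocked : ∀ α → Harmless Γ → IsSBC Γ (definitionClause α)
  set-blocked {Γ} α harmless = L , (λ ()) , ∈-++⁺ˡ , blocked
    where
    b = parity α vs
    L = pivots n b

    pivot-var : ∀ {p} → p ∈ L → ∃[ t ] var p ≡ encode n t
    pivot-var p∈ with ∈-pivots⁻ n b p∈
    ... | t , refl = t , var-literal b _

    ∉L : ∀ {p v} → var p ≡ v → v ∈ vs → p ∉ L
    ∉L refl v∈ p∈ with pivot-var p∈
    ... | t , eq = avoids t (subst (_∈ vs) eq v∈)

    compl-var : ∀ p → var (compl p) ≡ var p
    compl-var (pos _) = refl
    compl-var (neg _) = refl

    ∉complL : ∀ {p v} → var p ≡ v → v ∈ vs → p ∉ complAll L
    ∉complL refl v∈ p∈ with ∈-map⁻ compl p∈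
    ... | q , q∈ , refl with pivot-var q∈
    ...   | t , eq = avoids t (subst (_∈ vs) (trans (compl-var q) eq) v∈)

    blocked : ∀ D → D ∈ᶜ Γ → (∃[ p ] (p ∈ literals D × p ∈ complAll L)) →
              Disjoint (literals D) L →
              Tautological ((definitionLiterals n vs α ∖ L) ++ (literals D ∖ complAll L))
    blocked D D∈ touched disjoint with ∈ᶜ⇒∈ D D∈
    ... | E , E∈ , D⊆E , E⊆D with harmless E E∈
    blocked D D∈ (p , p∈D , p∈) disjoint | E , E∈ , D⊆E , E⊆D | inj₁ (inj₁ (c , inert)) =
      contradiction
        (E⊆D (subst (λ x → literal x (encode n (b xor c)) ∈ literals E) same (inert (b xor c))) ,
         ∈-pivots n b _) disjoint
      where
      same : (b xor c) xor c ≡ b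
      same = trans (xor-assoc b c c) (trans (cong (b xor_) (xor-same c)) (xor-identityʳ b))
    blocked D D∈ (p , p∈D , p∈) disjoint | E , E∈ , D⊆E , E⊆D | inj₁ (inj₂ absent) with ∈-map⁻ compl p∈
    ... | q , q∈ , refl with pivot-var q∈
    ...   | t , eq = contradiction
      (subst (_∈ vars (literals E)) (trans (compl-var q) eq) (∈-map⁺ var (D⊆E p∈D))) (absent t)
    blocked D D∈ (p , p∈D , p∈) disjoint | E , E∈ , D⊆E , E⊆D | inj₂ (β , refl) with parity β vs ≟ᵇ b
    ... | yes same = contradiction
      (E⊆D (subst (λ x → literal x _ ∈ literals E) same (here refl)) , ∈-pivots n b true) disjoint
    ... | no differ with parity-differs {α} {β} vs (differ ∘ sym)
    ...   | v , v∈ , v≢ = tautological {α} {β} v≢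
      (∈-filter⁺ (λ p → ¬? (p ∈ˡ? L)) (∈-++⁺ʳ L (∈-map⁺ (falseLiteral α) v∈))
        (∉L (var-literal (not (α v)) v) v∈))
      (∈-filter⁺ (λ p → ¬? (p ∈ˡ? complAll L))
        (E⊆D (∈-++⁺ʳ (pivots n (parity β vs)) (∈-map⁺ (falseLiteral β) v∈)))
        (∉complL (var-literal (not (β v)) v) v∈))

  add-definitions : ∀ αs → Fresh n Γ →
    Reach (_∈ definitionVars n vs) Γ (length αs)
      (λ Δ → Harmless Δ × (∀ α → α ∈ αs → definitionClause α ∈ Δ))
  add-definitions []       fresh = stay ((λ _ → inj₁ ∘ fresh) , λ _ ())
  add-definitions {Γ} (α ∷ αs) fresh = relaxᴿ (ℕ.≤-reflexive (ℕ.+-comm (length αs) 1))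
    (add-definitions αs fresh >>= λ { {Δ} _ (harmless , defined) →
      definitionClause α ∷ Δ ,
      add (definitionClause α) (inj₂ (set-blocked α harmless)) (⊆-reflexive (vars-definition n vs α)) ,
      (λ { _ (here refl) → inj₂ (α , refl) ; C (there C∈) → harmless C C∈ }) ,
      (λ { _ (here refl) → here refl ; β (there β∈) → there (defined β β∈) }) })

  -- An assignment violating the definition either separates the twins and falsifies a twin clause,
  -- or gives both the wrong parity and falsifies a definition clause. Then one twin is eliminated.
  define : Γ ⊩ twins n → Fresh n Γ →
    Reach (_∈ definitionVars n vs) Γ (2 ^ length vs + 2 ^ suc (length vs) * 3) (_⊩ definition n vs)
  define {Γ} twins⊩ fresh = relaxᴿ
    (ℕ.≤-reflexive (cong (_+ 2 ^ suc (length vs) * 3) (length-assignments vs)))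
    (add-definitions (assignments vs) fresh >>= λ { {Δ} st (_ , defined) →
      eliminate (encode n true) (encode n false ∷ vs) id id (refutes Δ st defined) })
    where
    refutes : ∀ Δ → Steps (_∈ definitionVars n vs) Γ Δ (length (assignments vs)) →
              (∀ α → α ∈ assignments vs → definitionClause α ∈ Δ) →
              Refutes Δ (definitionVars n vs) (definition n vs)
    refutes Δ st defined α odd with α (encode n true) ≟ᵇ α (encode n false)
    ... | no differ = W , Steps.extends st W∈ , λ p∈ → swap (W⊆ p∈)
      where
      violated : parity α (proj₁ (twins n)) ≢ false
      violated eq = differ (sym (xor-false⇒≡ _ _
        (trans (cong (α (encode n false) xor_) (sym (xor-identityʳ _))) eq)))
      W  = proj₁ (twins⊩ α violated)
      W∈ = proj₁ (proj₂ (twins⊩ α violated))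
      W⊆ : literals W ⊆ falsified α (proj₁ (twins n))
      W⊆ = proj₂ (proj₂ (twins⊩ α violated))
      swap : falsified α (proj₁ (twins n)) ⊆ falsified α (definitionVars n vs)
      swap (here refl)         = there (here refl)
      swap (there (here refl)) = here refl
    ... | yes same with assignments-complete α vs
    ...   | β , β∈ , β≡α = definitionClause β , defined β β∈ , ⊆-reflexive agree
      where
      opposite : not (α (encode n false)) ≡ parity β vs
      opposite = trans (flip _ _ odd) (sym (parity-cong {β} {α} vs β≡α))
        where
        flip : ∀ a b → a xor b ≢ false → not a ≡ b
        flip true  true  ≢ = contradiction refl ≢
        flip true  false ≢ = refl
        flip false true  ≢ = refl
        flip false false ≢ = contradiction refl ≢
      agree : definitionLiterals n vs β ≡ falsified α (definitionVars n vs)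
      agree = cong₂ _∷_ (cong (λ b → literal b _) (trans (sym opposite) (cong not (sym same))))
        (cong₂ _∷_ (cong (λ b → literal b _) (sym opposite)) (falsified-cong {β} {α} vs β≡α))

-- Defining the prefix parities within the formula

Used : ℕ → Var → Set
Used m v = v ∈ varsCNF (formula m)

used : ∀ m {t n} → t ∈ sites m → n ∈ names t → ∀ b → Used m (encode n b)
used m {n = n} t∈ n∈ b with twin-clause n true
... | C , C∈ , C≡ = ∈-concatMap⁺ (vars ∘ literals) (lose (block-twins m t∈ n∈ C∈)
  (subst (λ L → encode n b ∈ vars L) (sym C≡) (member b)))
  where
  member : ∀ b → encode n b ∈ encode n false ∷ [ encode n true ]
  member false = here refl
  member true  = there (here refl)

vertex∈ : ∀ {x y} → x < m → y < m → vertex x y ∈ sites m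
vertex∈ x<m y<m = ∈-++⁺ˡ (∈-cartesianProductWith⁺ vertex (∈-upTo⁺ x<m) (∈-upTo⁺ y<m))

direction∈ : ∀ d → d ∈ row ∷ [ column ]
direction∈ false = here refl
direction∈ true  = there (here refl)

source∈ : ∀ d {i} → i < m → boundary d i 0 (source d i) ∈ sites m
source∈ {m} d i<m = ∈-++⁺ʳ (vertexSites m) (∈-++⁺ˡ
  (∈-cartesianProductWith⁺ (λ d i → boundary d i 0 (source d i)) (direction∈ d) (∈-upTo⁺ i<m)))

sink∈ : ∀ d {i} → i < m → boundary d i m false ∈ sites m
sink∈ {m} d i<m = ∈-++⁺ʳ (vertexSites m) (∈-++⁺ʳ (sourceSites m) (∈-++⁺ˡ
  (∈-cartesianProductWith⁺ (λ d i → boundary d i m false) (direction∈ d) (∈-upTo⁺ i<m))))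

auxiliary∈ : ∀ {x y} → x ≤ m → y ≤ m → auxiliary x y ∈ sites m
auxiliary∈ {m} x≤m y≤m = ∈-++⁺ʳ (vertexSites m) (∈-++⁺ʳ (sourceSites m) (∈-++⁺ʳ (sinkSites m)
  (∈-cartesianProductWith⁺ auxiliary (∈-upTo⁺ (s≤s x≤m)) (∈-upTo⁺ (s≤s y≤m)))))

site-known : ∀ m t {e} → t ∈ sites m → e ∈ equations t → Known (Used m) (formula m) e
site-known m t {e} t∈ e∈ = clauses-⊩ e (λ C∈ → block⊆formula m t∈
    (∈-++⁺ˡ (∈-concatMap⁺ clauses (lose e∈ C∈)))) , allowed
  where
  allowed : ∀ {v} → v ∈ proj₁ e → Used m v
  allowed v∈ with ∈-map⁻ (λ n → encode n false) (subst (_ ∈_) (equation-vars t e∈) v∈)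
  ... | n , n∈ , refl = used m t∈ n∈ false

column-used : ∀ {x y} → x ≤ m → y < m → ∀ c b → Used m (encode (edge column y x c) b)
column-used {m} {zero} x≤m y<m false = used m (source∈ column y<m) (here refl)
column-used {m} {zero} x≤m y<m true  = used m (source∈ column y<m) (there (here refl))
column-used {m} {suc x} {y} x<m y<m c = used m (vertex∈ x<m y<m)
  (∈-++⁺ʳ (edgePair row x y ++ edgePair row x (suc y) ++ edgePair column y x) (copy c))
  where
  copy : ∀ c → edge column y (suc x) c ∈ edgePair column y (suc x)
  copy false = here refl
  copy true  = there (here refl)

row-used : ∀ {x y} → x < m → y ≤ m → ∀ c b → Used m (encode (edge row x y c) b)
row-used {m} {y = zero} x<m y≤m false = used m (source∈ row x<m) (here refl)
row-used {m} {y = zero} x<m y≤m true  = used m (source∈ row x<m) (there (here refl))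
row-used {m} {x} {suc y} x<m y<m c = used m (vertex∈ x<m y<m)
  (∈-++⁺ʳ (edgePair row x y) (∈-++⁺ˡ {ys = edgePair column y x ++ edgePair column y (suc x)} (copy c)))
  where
  copy : ∀ c → edge row x (suc y) c ∈ edgePair row x (suc y)
  copy false = here refl
  copy true  = there (here refl)

auxiliary-used : ∀ {x y} → x ≤ m → y ≤ m → ∀ b → Used m (encode (aux x y) b)
auxiliary-used {m} x≤m y≤m = used m (auxiliary∈ x≤m y≤m) (here refl)

-- aux x y is the parity of the column edges entering row x on columns 0, …, y − 1.
prefix : ℕ → ℕ → List Name
prefix x zero    = []
prefix x (suc y) = aux x y ∷ edgePair column y x

prefixEquation : ℕ → ℕ → Equation
prefixEquation x y = definition (aux x y) (unprimed (prefix x y))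

isEdge : Name → Bool
isEdge (edge _ _ _ _) = true
isEdge (aux _ _)      = false

edges-only : ∀ t {e} → e ∈ equations t → All (λ n → isEdge n ≡ true) (names t)
edges-only (vertex x y)       _ = refl ∷ refl ∷ refl ∷ refl ∷ refl ∷ refl ∷ refl ∷ refl ∷ []
edges-only (boundary d i k b) _ = refl ∷ refl ∷ []

different : ∀ {n n′} → n ≢ n′ → ∀ {t t′} → encode n t ≢ encode n′ t′
different n≢ eq = n≢ (cong proj₁ (encode-injective eq))

twin-inert : ∀ α n → parity α (proj₁ (twins n)) ≢ false → Inert n (falsified α (proj₁ (twins n)))
twin-inert α n odd = not (α (encode n false)) , opposite
  where
  negate : ∀ a b → a xor (b xor false) ≢ false → not b ≡ not (not a)
  negate true  true  ≢ = contradiction refl ≢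
  negate true  false ≢ = refl
  negate false true  ≢ = refl
  negate false false ≢ = contradiction refl ≢
  opposite : ∀ t → literal (t xor not (α (encode n false))) (encode n t) ∈ falsified α (proj₁ (twins n))
  opposite false = here refl
  opposite true  = there (here (cong (λ b → literal b (encode n true)) (sym (negate _ _ odd))))

twin-absent : ∀ α n n′ → n′ ≢ n → Absent n′ (falsified α (proj₁ (twins n)))
twin-absent α n n′ n≢ t v∈ with subst (encode n′ t ∈_) (vars-falsified α (proj₁ (twins n))) v∈
... | here eq         = different n≢ eq
... | there (here eq) = different n≢ eq

twin-fresh : ∀ α n x y → parity α (proj₁ (twins n)) ≢ false →
  Inert (aux x y) (falsified α (proj₁ (twins n))) ⊎ Absent (aux x y) (falsified α (proj₁ (twins n)))
twin-fresh α n@(edge _ _ _ _) x y odd = inj₂ (twin-absent α n _ λ ())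
twin-fresh α n@(aux x′ y′) x y odd with x ℕ.≟ x′ | y ℕ.≟ y′
... | yes refl | yes refl = inj₁ (twin-inert α n odd)
... | no x≢    | _        = inj₂ (twin-absent α n _ λ { refl → x≢ refl })
... | yes _    | no y≢    = inj₂ (twin-absent α n _ λ { refl → y≢ refl })

-- The vertex and boundary equations mention edges only, and a twin clause contains both twins of
-- `aux x y` with opposite signs or neither.
formula-fresh : ∀ m x y → Fresh (aux x y) (formula m)
formula-fresh m x y C∈ with origin m C∈
... | main t t∈ vs b e∈ C∈e with ∈-clauses⁻ vs b C∈e
...   | α , refl , _ = inj₂ λ s v∈ → absent s (∈-map⁻ (λ n → encode n false)
  (subst (_ ∈_) (trans (vars-falsified α vs) (equation-vars t e∈)) v∈))
  where
  absent : ∀ s → ¬ (∃[ n ] (n ∈ names t × encode (aux x y) s ≡ encode n false))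
  absent s (n , n∈ , eq) with encode-injective eq
  ... | refl = contradiction (All.lookup (edges-only t e∈) n∈) λ ()
formula-fresh m x y C∈ | twin t t∈ n n∈ C∈n with ∈-clauses⁻ (proj₁ (twins n)) false C∈n
... | α , refl , odd = twin-fresh α n x y odd

prefix-avoids : ∀ x y t → encode (aux x y) t ∉ unprimed (prefix x y)
prefix-avoids x (suc y) t (here eq) with encode-injective eq
... | ()
prefix-avoids x (suc y) t (there (here eq)) with encode-injective eq
... | ()
prefix-avoids x (suc y) t (there (there (here eq))) with encode-injective eq
... | ()

-- Besides `aux X Y` itself, its definition mentions only the preceding prefix of the same row,
-- hence the two exclusions.
aux-absent : ∀ {x y X Y} → ¬ (x ≡ X × y ≡ Y) → ¬ (x ≡ X × suc y ≡ Y) →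
             ∀ t → encode (aux x y) t ∉ definitionVars (aux X Y) (unprimed (prefix X Y))
aux-absent ≢₁ ≢₂ t (here eq) with encode-injective eq
... | refl = ≢₁ (refl , refl)
aux-absent ≢₁ ≢₂ t (there (here eq)) with encode-injective eq
... | refl = ≢₁ (refl , refl)
aux-absent {Y = suc Y} ≢₁ ≢₂ t (there (there (here eq))) with encode-injective eq
... | refl = ≢₂ (refl , refl)
aux-absent {Y = suc Y} ≢₁ ≢₂ t (there (there (there (here eq)))) with encode-injective eq
... | ()
aux-absent {Y = suc Y} ≢₁ ≢₂ t (there (there (there (there (here eq))))) with encode-injective eq
... | ()

Fresh-after : ∀ {n vs} → Steps (_∈ vs) Γ Δ c → Fresh n Γ → (∀ t → encode n t ∉ vs) → Fresh n Δ
Fresh-after st fresh absent C∈ with Steps.new st C∈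
... | inj₁ C∈Γ = fresh C∈Γ
... | inj₂ ⊆vs = inj₂ λ t v∈ → absent t (⊆vs v∈)

prefix-used : ∀ {x} y → x ≤ m → y ≤ m →
  ∀ {v} → v ∈ definitionVars (aux x y) (unprimed (prefix x y)) → Used m v
prefix-used y x≤m y≤m (here refl) = auxiliary-used x≤m y≤m true
prefix-used y x≤m y≤m (there (here refl)) = auxiliary-used x≤m y≤m false
prefix-used (suc y) x≤m y<m (there (there (here refl))) = auxiliary-used x≤m (ℕ.<⇒≤ y<m) false
prefix-used (suc y) x≤m y<m (there (there (there (here refl)))) = column-used x≤m y<m false false
prefix-used (suc y) x≤m y<m (there (there (there (there (here refl))))) = column-used x≤m y<m true false

broaden : ∀ {Q′ : Var → Set} → (∀ {v} → Q v → Q′ v) → Steps Q Γ Δ c → Steps Q′ Γ Δ c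
broaden {Q = Q} {Γ = Γ} {Q′ = Q′} f st = record
  { derivation = Steps.derivation st ; bounded = Steps.bounded st
  ; extends = Steps.extends st ; new = λ C∈ → allowed (Steps.new st C∈) }
  where
  allowed : ∀ {C} → C ∈ Γ ⊎ (∀ {v} → v ∈ vars (literals C) → Q v) →
            C ∈ Γ ⊎ (∀ {v} → v ∈ vars (literals C) → Q′ v)
  allowed (inj₁ C∈) = inj₁ C∈
  allowed (inj₂ q)  = inj₂ λ v∈ → f (q v∈)

-- An empty prefix costs 1 + 2 · 3 = 7, and one of three variables 8 + 16 · 3 = 56; both are below 3
-- · 2⁵ = 96.
definition-cost : ∀ y x →
  2 ^ length (unprimed (prefix x y)) + 2 ^ suc (length (unprimed (prefix x y))) * 3 ≤ unitCost
definition-cost zero    x = ℕ.≤-trans (ℕ.≤ᵇ⇒≤ 7 96 tt) (unitCost-bound 5 (ℕ.≤ᵇ⇒≤ 5 24 tt))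
definition-cost (suc y) x = ℕ.≤-trans (ℕ.≤ᵇ⇒≤ 56 96 tt) (unitCost-bound 5 (ℕ.≤ᵇ⇒≤ 5 24 tt))

module Definitions (m : ℕ) where

  Defined : CNF → ℕ → ℕ → Set
  Defined Δ x y = Known (Used m) Δ (prefixEquation x y)

  -- Loop invariant with y as the outer index: no `aux x y` is mentioned by a definition made before
  -- its own, so it is still fresh when its turn comes.
  Rows : ℕ → CNF → Set
  Rows Y Δ = (∀ x y → x ≤ m → y < Y → Defined Δ x y) × (∀ x y → Y ≤ y → Fresh (aux x y) Δ)

  Cells : ℕ → ℕ → CNF → Set
  Cells Y X Δ = (∀ x y → x ≤ m → y < Y → Defined Δ x y) × (∀ x → x < X → Defined Δ x Y) ×
                (∀ x y → Y < y ⊎ (y ≡ Y × X ≤ x) → Fresh (aux x y) Δ)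

  define-cell : ∀ {X Y} → X ≤ m → Y ≤ m → formula m ⊆ Γ → Cells Y X Γ →
                Reach (Used m) Γ unitCost (Cells Y (suc X))
  define-cell {Γ} {X} {Y} X≤m Y≤m ⊆Γ (rows , cells , fresh) = finish
    (define (aux X Y) (unprimed (prefix X Y)) (prefix-avoids X Y)
      (clauses-⊩ (twins (aux X Y)) (⊆Γ ∘ block-twins m (auxiliary∈ X≤m Y≤m) (here refl)))
      (fresh X Y (inj₂ (refl , ℕ.≤-refl))))
    where
    finish : Reach (_∈ definitionVars (aux X Y) (unprimed (prefix X Y))) Γ _ (_⊩ prefixEquation X Y) →
             Reach (Used m) Γ unitCost (Cells Y (suc X))
    finish (Δ , st , ref) = Δ , relax (definition-cost Y X) (broaden (prefix-used Y X≤m Y≤m) st) ,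
      (λ x y x≤ y< → Known-mono _ (Steps.extends st) (rows x y x≤ y<)) , cells′ , fresh′
      where
      cells′ : ∀ x → x < suc X → Defined Δ x Y
      cells′ x x<1+X with ℕ.m≤n⇒m<n∨m≡n (s≤s⁻¹ x<1+X)
      ... | inj₁ x<X  = Known-mono _ (Steps.extends st) (cells x x<X)
      ... | inj₂ refl = ref , prefix-used Y X≤m Y≤m ∘ there
      fresh′ : ∀ x y → Y < y ⊎ (y ≡ Y × suc X ≤ x) → Fresh (aux x y) Δ
      fresh′ x y (inj₁ Y<y) = Fresh-after st (fresh x y (inj₁ Y<y))
        (aux-absent (λ { (_ , refl) → ℕ.n≮n _ Y<y })
        (λ { (_ , refl) → ℕ.n≮n _ (ℕ.<-trans (ℕ.n<1+n _) Y<y) }))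
      fresh′ x y (inj₂ (refl , X<x)) = Fresh-after st (fresh x y (inj₂ (refl , ℕ.<⇒≤ X<x)))
        (aux-absent (λ { (refl , _) → ℕ.n≮n _ X<x }) (λ { (refl , _) → ℕ.n≮n _ X<x }))

  define-row : ∀ {Y} → Y ≤ m → formula m ⊆ Γ → Rows Y Γ →
    Reach (Used m) Γ (suc m * unitCost) (Rows (suc Y))
  define-row {Γ} {Y} Y≤m ⊆Γ (rows , fresh) = finish (iterate (Cells Y) (suc m)
    (λ X<1+m ⊆Δ cells → define-cell (s≤s⁻¹ X<1+m) Y≤m (⊆Δ ∘ ⊆Γ) cells)
    (rows , (λ _ ()) , λ x y → [ fresh x y ∘ ℕ.<⇒≤ , (λ { (refl , _) → fresh x y ℕ.≤-refl }) ]′))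
    where
    finish : Reach (Used m) Γ (suc m * unitCost) (Cells Y (suc m)) →
      Reach (Used m) Γ (suc m * unitCost) (Rows (suc Y))
    finish (Δ , st , rows′ , cells , fresh′) = Δ , st , rows″ , λ x y Y<y → fresh′ x y (inj₁ Y<y)
      where
      rows″ : ∀ x y → x ≤ m → y < suc Y → Defined Δ x y
      rows″ x y x≤m y<1+Y with ℕ.m≤n⇒m<n∨m≡n (s≤s⁻¹ y<1+Y)
      ... | inj₁ y<Y  = rows′ x y x≤m y<Y
      ... | inj₂ refl = cells x (s≤s x≤m)

  define-all : Reach (Used m) (formula m) (suc m * (suc m * unitCost)) (Rows (suc m))
  define-all = iterate Rows (suc m)
    (λ Y<1+m ⊆Δ rows → define-row (s≤s⁻¹ Y<1+m) ⊆Δ rows)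
    ((λ _ _ _ ()) , λ x y _ → formula-fresh m x y)

-- The refutation

-- The sum of the source equation and the first y vertex equations of row x: the row edge at
-- position y carries the difference of the prefixes above and below the row.
rowEquation : ℕ → ℕ → Equation
rowEquation x y = unprimed (edgePair row x y ++ aux x y ∷ [ aux (suc x) y ]) , false

valueEquation : ℕ → ℕ → Bool → Equation
valueEquation x y b = unprimed [ aux x y ] , b

vertexEquation : ℕ → ℕ → Equation
vertexEquation x y = unprimed (names (vertex x y)) , false

boundaryEquation : Bool → ℕ → ℕ → Bool → Equation
boundaryEquation d i k b = unprimed (edgePair d i k) , b

-- As in the three inferences after it, the conclusion is the sum of the premises modulo 2, and the
-- solver checks that the other variables cancel.
row-start : ∀ x α →
  All (Holds α) (boundaryEquation row x 0 false ∷ prefixEquation x 0 ∷ [ prefixEquation (suc x) 0 ]) →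
  Holds α (rowEquation x 0)
row-start x α (b ∷ p ∷ q ∷ []) = trans
  (solve 4 (λ e e′ r s → e :+ (e′ :+ (r :+ (s :+ con false))) :=
     (e :+ (e′ :+ con false)) :+ ((r :+ con false) :+ (s :+ con false))) refl
    (val (edge row x 0 false)) (val (edge row x 0 true)) (val (aux x 0)) (val (aux (suc x) 0)))
  (cong₂ _xor_ b (cong₂ _xor_ p q))
  where
  open xor-∧-Solver
  val : Name → Bool
  val n = α (encode n false)

row-step : ∀ x y α → All (Holds α) (rowEquation x y ∷ vertexEquation x y ∷
             prefixEquation x (suc y) ∷ [ prefixEquation (suc x) (suc y) ]) →
           Holds α (rowEquation x (suc y))
row-step x y α (a ∷ v ∷ p ∷ q ∷ []) = trans
  (solve 12 (λ e₀ e₁ f₀ f₁ g₀ g₁ h₀ h₁ r s r′ s′ →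
     f₀ :+ (f₁ :+ (r′ :+ (s′ :+ con false))) :=
     ((e₀ :+ (e₁ :+ (r :+ (s :+ con false)))) :+
      (e₀ :+ (e₁ :+ (f₀ :+ (f₁ :+ (g₀ :+ (g₁ :+ (h₀ :+ (h₁ :+ con false))))))))) :+
     ((r′ :+ (r :+ (g₀ :+ (g₁ :+ con false)))) :+ (s′ :+ (s :+ (h₀ :+ (h₁ :+ con false)))))) refl
    (val (edge row x y false)) (val (edge row x y true))
    (val (edge row x (suc y) false)) (val (edge row x (suc y) true))
    (val (edge column y x false)) (val (edge column y x true))
    (val (edge column y (suc x) false)) (val (edge column y (suc x) true))
    (val (aux x y)) (val (aux (suc x) y)) (val (aux x (suc y))) (val (aux (suc x) (suc y))))
  (cong₂ _xor_ (cong₂ _xor_ a v) (cong₂ _xor_ p q))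
  where
  open xor-∧-Solver
  val : Name → Bool
  val n = α (encode n false)

row-end : ∀ x m α →
  All (Holds α) (rowEquation x m ∷ boundaryEquation row x m false ∷ [ valueEquation x m true ]) →
  Holds α (valueEquation (suc x) m true)
row-end x m α (a ∷ b ∷ r ∷ []) = trans
  (solve 4 (λ e e′ r s → s :+ con false :=
     (e :+ (e′ :+ (r :+ (s :+ con false)))) :+ ((e :+ (e′ :+ con false)) :+ (r :+ con false))) refl
    (val (edge row x m false)) (val (edge row x m true)) (val (aux x m)) (val (aux (suc x) m)))
  (cong₂ _xor_ a (cong₂ _xor_ b r))
  where
  open xor-∧-Solver
  val : Name → Bool
  val n = α (encode n false)

prefix-step : ∀ x y c b α → All (Holds α)
    (prefixEquation x (suc y) ∷ valueEquation x y c ∷ [ boundaryEquation column y x b ]) →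
  Holds α (valueEquation x (suc y) (c xor b))
prefix-step x y c b α (p ∷ r ∷ g ∷ []) = trans
  (solve 4 (λ r′ r g g′ → r′ :+ con false :=
     (r′ :+ (r :+ (g :+ (g′ :+ con false)))) :+ ((r :+ con false) :+ (g :+ (g′ :+ con false)))) refl
    (val (aux x (suc y))) (val (aux x y)) (val (edge column y x false)) (val (edge column y x true)))
  (cong₂ _xor_ p (cong₂ _xor_ r g))
  where
  open xor-∧-Solver
  val : Name → Bool
  val n = α (encode n false)

module Refutation (m : ℕ) (0<m : 0 < m) {Γ : CNF} (formula⊆ : formula m ⊆ Γ)
  (defined : ∀ x y → x ≤ m → y ≤ m → Known (Used m) Γ (prefixEquation x y)) where

  Derivable : CNF → Equation → Set
  Derivable = Known (Used m)

  site-derivable : ∀ t {e} → Γ ⊆ Δ → t ∈ sites m → e ∈ equations t → Derivable Δ e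
  site-derivable t {e} Γ⊆Δ t∈ e∈ = Known-mono e (Γ⊆Δ ∘ formula⊆) (site-known m t t∈ e∈)

  prefix-derivable : ∀ {x y} → Γ ⊆ Δ → x ≤ m → y ≤ m → Derivable Δ (prefixEquation x y)
  prefix-derivable {x = x} {y} Γ⊆Δ x≤m y≤m = Known-mono (prefixEquation x y) Γ⊆Δ (defined x y x≤m y≤m)

  Derive : CNF → ℕ → Equation → Set
  Derive Δ c e = Reach (Used m) Δ c (λ Θ → Derivable Θ e)

  value-used : ∀ {x y b} → x ≤ m → y ≤ m → ∀ {v} → v ∈ proj₁ (valueEquation x y b) → Used m v
  value-used x≤m y≤m (here refl) = auxiliary-used x≤m y≤m false

  -- For the two sides of the grid where the column edges have prescribed values b; c lists their
  -- partial sums.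
  prefixes : ∀ x (b c : ℕ → Bool) → x ≤ m →
    (∀ {y} → y < m → boundary column y x (b y) ∈ sites m) →
    c 0 ≡ false → (∀ y → c (suc y) ≡ c y xor b y) →
    Γ ⊆ Δ → Derive Δ (m * unitCost) (valueEquation x m (c m))
  prefixes x b c x≤m boundary∈ c₀ c₊ Γ⊆Δ = iterate (λ y Θ → Derivable Θ (valueEquation x y (c y))) m
    (λ {y} y<m Δ⊆Θ known → subst (λ v → Derive _ _ (valueEquation x (suc y) v)) (sym (c₊ y))
      (infer (prefixEquation x (suc y) ∷ valueEquation x y (c y) ∷ [ boundaryEquation column y x (b y) ])
        (prefix-derivable (Δ⊆Θ ∘ Γ⊆Δ) x≤m y<m ∷ known ∷
         site-derivable (boundary column y x (b y)) (Δ⊆Θ ∘ Γ⊆Δ) (boundary∈ y<m) (here refl) ∷ [])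
        (prefix-step x y (c y) (b y))
        (value-used {b = c y xor b y} x≤m y<m)))
    (subst (λ v → Derivable _ (valueEquation x 0 v)) (sym c₀) (prefix-derivable Γ⊆Δ x≤m z≤n))

  row-used-in : ∀ {x y} → x < m → y ≤ m → ∀ {v} → v ∈ proj₁ (rowEquation x y) → Used m v
  row-used-in x<m y≤m (here refl) = row-used x<m y≤m false false
  row-used-in x<m y≤m (there (here refl)) = row-used x<m y≤m true false
  row-used-in x<m y≤m (there (there (here refl))) = auxiliary-used (ℕ.<⇒≤ x<m) y≤m false
  row-used-in x<m y≤m (there (there (there (here refl)))) = auxiliary-used x<m y≤m false

  next-cell : ∀ {x y} → x < m → y < m → Γ ⊆ Δ → Derivable Δ (rowEquation x y) →
              Derive Δ unitCost (rowEquation x (suc y))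
  next-cell {x = x} {y} x<m y<m Γ⊆Δ known =
    infer (rowEquation x y ∷ vertexEquation x y ∷ prefixEquation x (suc y) ∷ [ prefixEquation (suc x) (suc y) ])
      (known ∷ site-derivable (vertex x y) Γ⊆Δ (vertex∈ x<m y<m) (here refl) ∷
       prefix-derivable Γ⊆Δ (ℕ.<⇒≤ x<m) y<m ∷ prefix-derivable Γ⊆Δ x<m y<m ∷ [])
      (row-step x y) (row-used-in x<m y<m)

  -- The row equation is carried from the source of row x to its sink. The edge there is 0, so the
  -- totals entering and leaving the row agree.
  next-row : ∀ {x} → x < m → Γ ⊆ Δ → Derivable Δ (valueEquation x m true) →
             Derive Δ (unitCost + (m * unitCost + unitCost)) (valueEquation (suc x) m true)
  next-row {x = x} x<m Γ⊆Δ known =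
    infer (boundaryEquation row x 0 false ∷ prefixEquation x 0 ∷ [ prefixEquation (suc x) 0 ])
      (site-derivable (boundary row x 0 false) Γ⊆Δ (source∈ row x<m) (here refl) ∷
       prefix-derivable Γ⊆Δ (ℕ.<⇒≤ x<m) z≤n ∷ prefix-derivable Γ⊆Δ x<m z≤n ∷ [])
      (row-start x) (row-used-in x<m z≤n) >>= λ st first →
    iterate (λ y Θ → Derivable Θ (rowEquation x y)) m
      (λ y<m ⊆Θ → next-cell x<m y<m (λ C∈ → ⊆Θ (Steps.extends st (Γ⊆Δ C∈))))
      first >>= λ st′ last →
    infer (rowEquation x m ∷ boundaryEquation row x m false ∷ [ valueEquation x m true ])
      (last ∷
       site-derivable (boundary row x m false) (λ C∈ → Steps.extends st′ (Steps.extends st (Γ⊆Δ C∈)))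
         (sink∈ row x<m) (here refl) ∷
       Known-mono (valueEquation x m true) (λ C∈ → Steps.extends st′ (Steps.extends st C∈)) known ∷ [])
      (row-end x m) (value-used {b = true} x<m ℕ.≤-refl)

  -- The total entering row 0 is odd and every row passes it on, but the total leaving the last row
  -- is even.
  refutation : Derive Γ
    (m * unitCost + (m * (unitCost + (m * unitCost + unitCost)) + (m * unitCost + unitCost)))
    ([] , true)
  refutation =
    prefixes 0 (λ y → y ≡ᵇ 0) (λ y → 0 <ᵇ y) z≤n (source∈ column) refl
      (λ { zero → refl ; (suc y) → refl }) id >>= λ {Δ} st top →
    iterate (λ x Θ → Derivable Θ (valueEquation x m true)) m
      (λ x<m ⊆Θ known → next-row x<m (λ C∈ → ⊆Θ (Steps.extends st C∈)) known)
      -- Since m is positive, the full prefix includes the odd source of column 0.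
      (subst (λ b → Derivable Δ (valueEquation 0 m b)) (<⇒<ᵇ≡true 0<m) top) >>= λ st′ one →
    prefixes m (λ _ → false) (λ _ → false) ℕ.≤-refl (sink∈ column) refl (λ _ → refl)
      (λ C∈ → Steps.extends st′ (Steps.extends st C∈)) >>= λ st″ none →
    infer (valueEquation m m true ∷ [ valueEquation m m false ])
      (Known-mono (valueEquation m m true) (Steps.extends st″) one ∷ none ∷ [])
      (λ { α (t ∷ f ∷ []) → trans (sym f) t }) (λ ())

-- The upper bound and the theorem

cost : ℕ → ℕ
cost m = suc m * (suc m * unitCost) +
  (m * unitCost + (m * (unitCost + (m * unitCost + unitCost)) + (m * unitCost + unitCost)))

upper-bound : 0 < m → ∃[ N ] (N ≤ suc (cost m) × Proof⁻ SBC (formula m) N)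
upper-bound {m} 0<m = conclude (Definitions.define-all m >>= λ { {Δ} st (rows , _) →
    Refutation.refutation m 0<m (Steps.extends st) (λ x y x≤m y≤m → rows x y x≤m (s≤s y≤m)) })
  where
  conclude : Reach (Used m) (formula m) (cost m) (λ Δ → Known (Used m) Δ ([] , true)) →
             ∃[ N ] (N ≤ suc (cost m) × Proof⁻ SBC (formula m) N)
  conclude (Δ , st , ref , _) with ref (λ _ → false) (λ ())
  ... | C , C∈ , C⊆[] = _ , Steps.bounded st , Δ , Steps.derivation st ,
    lose C∈ (mk⇔ (λ ()) C⊆[]) , allowed
    where
    allowed : varsCNF Δ ⊆ varsCNF (formula m)
    allowed v∈ with ∈-varsCNF⁻ Δ v∈
    ... | D , D∈ , v∈D with Steps.new st D∈
    ...   | inj₁ D∈Γ = ∈-concatMap⁺ (vars ∘ literals) (lose D∈Γ v∈D)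
    ...   | inj₂ q   = q v∈D

-- The size is `1 + unitCost * (18n² + 54n + 38)`. Absorbing the 1 and raising all powers of n to n²
-- gives the factor 18 + 54 + 39 = 111, so n³ suffices from `111 * unitCost` on.
cost-bound : ∀ n → 111 * unitCost ≤ n → suc (cost (3 * suc n)) ≤ n ^ 3
cost-bound n large = begin
  suc (cost (3 * suc n))
    ≡⟨ solve 2 (λ n k → let m = con 3 :* (con 1 :+ n) in
         con 1 :+ ((con 1 :+ m) :* ((con 1 :+ m) :* k) :+
           (m :* k :+ (m :* (k :+ (m :* k :+ k)) :+ (m :* k :+ k))))
         := con 1 :+ k :* (con 18 :* (n :* n) :+ (con 54 :* n :+ con 38))) refl n k ⟩
  1 + k * (18 * (n * n) + (54 * n + 38))
    ≤⟨ ℕ.+-monoˡ-≤ _ 1≤k ⟩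
  k + k * (18 * (n * n) + (54 * n + 38))
    ≡⟨ solve 2 (λ n k → k :+ k :* (con 18 :* (n :* n) :+ (con 54 :* n :+ con 38))
         := k :* (con 18 :* (n :* n) :+ (con 54 :* (con 1 :* n) :+ con 39 :* (con 1 :* con 1)))) refl n k ⟩
  k * (18 * (n * n) + (54 * (1 * n) + 39 * (1 * 1)))
    ≤⟨ ℕ.*-monoʳ-≤ k (ℕ.+-monoʳ-≤ (18 * (n * n)) (ℕ.+-mono-≤ (ℕ.*-monoʳ-≤ 54 (ℕ.*-monoˡ-≤ n 1≤n))
         (ℕ.*-monoʳ-≤ 39 (ℕ.*-mono-≤ 1≤n 1≤n)))) ⟩
  k * (18 * (n * n) + (54 * (n * n) + 39 * (n * n)))
    ≡⟨ solve 2 (λ n k → k :* (con 18 :* (n :* n) :+ (con 54 :* (n :* n) :+ con 39 :* (n :* n)))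
         := con 111 :* k :* (n :* n)) refl n k ⟩
  111 * k * (n * n)
    ≤⟨ ℕ.*-monoˡ-≤ (n * n) large ⟩
  n * (n * n)
    ≡⟨ cong (λ x → n * (n * x)) (ℕ.*-identityʳ n) ⟨
  n ^ 3 ∎
  where
  open ℕ.≤-Reasoning
  open +-*-Solver
  k = unitCost
  1≤k : 1 ≤ k
  1≤k = ℕ.≤-trans (s≤s z≤n) (unitCost-bound 0 z≤n)
  1≤n : 1 ≤ n
  1≤n = ℕ.≤-trans 1≤k (ℕ.≤-trans (ℕ.m≤n*m k 111) large)

theorem1p4 : Σ[ Γ ∈ (ℕ → CNF) ]
    ( AdmitsPolynomialSize (λ n N → Proof⁻ SBC (Γ n) N)
    × RequiresExponentialSize (λ n N → Proof⁻ RAT (Γ n) N))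
theorem1p4 = (λ n → formula (3 * suc n)) ,
  ( (λ n → proj₁ (upper-bound {3 * suc n} (s≤s z≤n)))
  , (3 , 111 * unitCost , λ n large → ℕ.≤-trans
      (proj₁ (proj₂ (upper-bound {3 * suc n} (s≤s z≤n)))) (cost-bound n large))
  , λ n _ → proj₂ (proj₂ (upper-bound {3 * suc n} (s≤s z≤n))) )
  , 1 , s≤s z≤n , 0 , λ n _ N → exponential n N
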